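{- Let $G=(V,E)$ be a connected $n$-vertex graph and let $\mathcal{H}^0=(\mathcal{C},E(\mathcal{H}^0))$ be a base hierarchy of $G$ (as defined in the context). Let $f\ge 1$ be an integer. There exists a partition $(S_1,\ldots,S_{f+1})$ of $V$ such that each $S\in\{S_1,\ldots,S_{f+1}\}$ is associated with a hierarchy $\mathcal{H}(S)$ of components $\mathcal{K}(S)$ that partition $V$, and the following hold. 1. $\mathcal{H}=\mathcal{H}(S)=(\mathcal{K}(S),E(\mathcal{H}(S)))$ is a coarsening of $\mathcal{H}^0$: $\mathcal{K}(S)$ is obtained by unifying connected subtrees of $\mathcal{H}^0$. $\mathcal{H}$ inherits the following properties of $\mathcal{H}^0$: (a) $\mathcal{H}$ has height at most $\log n$; (b) if $\{u,v\}\in E$ and $K_u,K_v\in\mathcal{K}(S)$ are the components containing $u,v$, then $K_u\prec K_v$ or $K_v\preceq K_u$; (c) for each $K\in\mathcal{K}(S)$, the subgraph of $G$ induced by $V(\mathcal{H}_K)=\bigcup_{K'\preceq K}K'$ is connected, and if $K'$ is a child of $K$ then $E\cap(K\times V(\mathcal{H}_{K'}))\ne\emptyset$. 2. Each $K\in\mathcal{K}(S)$ has a spanning tree $T(K)$ in the subgraph of $G$ induced by $K$. All vertices in $K-S$ have degree at most $3\log n$ in $T(K)$, whereas vertices of $S$ can have arbitrarily large degree. 3. For $K\in\mathcal{K}(S)$, let $N(\mathcal{H}_K)$ be the set of vertices in $V-V(\mathcal{H}_K)$ that are adjacent in $G$ to some vertex in $V(\mathcal{H}_K)$. Then $|N(\mathcal{H}_K)|=O(f\log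 n)$.
   Context: Logarithms are base 2. For a rooted tree whose nodes are the classes of a partition of $V$, $\gamma\prec\gamma'$ means that $\gamma$ is a strict descendant of $\gamma'$, and $\preceq$ means $\prec$ or $=$. A base hierarchy of $G$ is a partition $\mathcal{C}$ of $V$ together with a rooted tree $\mathcal{H}^0=(\mathcal{C},E(\mathcal{H}^0))$ such that: (1) $\mathcal{H}^0$ has height at most $\log n$. (2) If $\{u,v\}\in E$ and $\gamma_u,\gamma_v\in\mathcal{C}$ are the parts containing $u,v$, then $\gamma_u\prec\gamma_v$ or $\gamma_v\preceq\gamma_u$. (3) For every $\gamma\in\mathcal{C}$, the subgraph of $G$ induced by $V(\mathcal{H}^0_\gamma)=\bigcup_{\gamma'\preceq\gamma}\gamma'$ is connected; in particular, for every $\gamma\in\mathcal{C}$ and child $\gamma'$ of $\gamma$, $E\cap(\gamma\times V(\mathcal{H}^0_{\gamma'}))\neq\emptyset$. (4) Each $\gamma\in\mathcal{C}$ is spanned by a Steiner tree $T^0(\gamma)$, i.e. a tree that is a subgraph of $G$ containing all vertices of $\gamma$ (and possibly vertices not in $\gamma$), with maximum degree at most $4$; further, the maximum degree of the graph $T^\cup=\bigcup_{\gamma\in\mathcal{C}}T^0(\gamma)$ is at most $2\log n$. (It is known that every connected graph has a base hierarchy.) "Unifying connected subtrees of $\mathcal{H}^0$" means that the nodes of $\mathcal{H}^0$ are partitioned into sets each inducing a connected subtree of $\mathcal{H}^0$; each $K\in\mathcal{K}(S)$ is the union of the parts $\gamma$ in one such set, and $\mathcal{H}(S)$ is the rooted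 tree obtained from $\mathcal{H}^0$ by contracting each of these subtrees to one node. $\mathcal{H}_K$ is the subtree of $\mathcal{H}$ rooted at $K$. The classes $S_i$ of the partition may be empty. The $O(\cdot)$ constant is absolute. -}

module Defs where

open import Data.Nat using (ℕ; suc; _≤_; _^_; _⊔_)
open import Data.Fin using (Fin; _≟_)
open import Data.Fin.Properties using (any?)
open import Data.Fin.Subset using (Subset; _∈_; _⊆_; ⊤; ∣_∣)
open import Data.Fin.Subset.Properties using (_∈?_)
open import Data.List using (List; _∷_; _∷ʳ_; length; map; foldr; allFin)
open import Data.List.Relation.Unary.Linked using (Linked)
open import Data.List.Relation.Unary.Unique.Propositional using (Unique)
open import Data.Maybe using (Maybe; just; nothing)
open import Data.Product using (∃-syntax; ∃!; _×_; _,_)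
open import Data.Sum using (_⊎_)
open import Data.Vec using (tabulate)
open import Data.Vec.Properties using (lookup∘tabulate; lookup⇒[]=)
open import Function using (_⇔_)
open import Function.Definitions using (Surjective)
open import Relation.Binary.Construct.Closure.ReflexiveTransitive using (Star; ε; _◅_; fold)
open import Relation.Binary.Construct.Closure.Symmetric using (SymClosure)
open import Relation.Binary.Construct.Closure.Transitive using (TransClosure)
open import Relation.Binary.Definitions using (Symmetric; Irreflexive; Decidable)
open import Relation.Binary.PropositionalEquality using (_≡_; _≢_; refl; sym; trans)
open import Relation.Nullary using (¬_; Dec; yes; no; does; contradiction)
open import Relation.Nullary.Decidable using (_×-dec_; ¬?; dec-true; map′)
import Relation.Unary as U

-- k ≤ c · log₂ n with the real logarithm: for n ≥ 1 and natural k, c this is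
-- 2ᵏ ≤ nᶜ, with no rounding involved.
infix 4 _≤_·log₂_
_≤_·log₂_ : ℕ → ℕ → ℕ → Set
k ≤ c ·log₂ n = 2 ^ k ≤ n ^ c

⟦_⟧ : ∀ {n} {P : Fin n → Set} → U.Decidable P → Subset n
⟦ P? ⟧ = tabulate (λ x → does (P? x))

∈-⟦⟧⁺ : ∀ {n} {P : Fin n → Set} (P? : U.Decidable P) {x : Fin n} → P x → x ∈ ⟦ P? ⟧
∈-⟦⟧⁺ P? {x} px =
  lookup⇒[]= x ⟦ P? ⟧ (trans (lookup∘tabulate (λ y → does (P? y)) x) (dec-true (P? x) px))

-- Classes may be empty.
IsPartition : ∀ {n k} → (Fin k → Subset n) → Set
IsPartition S = ∀ v → ∃! _≡_ (λ i → v ∈ S i)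

------------------------------------------------------------------------
-- Finite simple graphs

-- Simple graphs with vertex set W ⊆ Fin n.  The ambient n-vertex graph is a
-- Graph ⊤; its subgraphs are indexed by their own vertex sets.
record Graph {n : ℕ} (W : Subset n) : Set₁ where
  field
    Adj        : Fin n → Fin n → Set
    adj?       : Decidable Adj
    adj-sym    : Symmetric Adj
    adj-irrefl : Irreflexive _≡_ Adj
    adj-in     : ∀ {u v} → Adj u v → u ∈ W

open Graph public

module _ {n : ℕ} {W : Subset n} (G : Graph W) where

  degree : Fin n → ℕ
  degree v = ∣ ⟦ adj? G v ⟧ ∣

  Connected : Set
  Connected = ∀ {u v} → u ∈ W → v ∈ W → Star (Adj G) u v

  -- The cyclic sequence x, xs, x.
  IsCycle : Fin n → List (Fin n) → Set
  IsCycle x xs = 2 ≤ length xs × Unique (x ∷ xs) × Linked (Adj G) (x ∷ xs ∷ʳ x)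

  Acyclic : Set
  Acyclic = ∀ x xs → ¬ IsCycle x xs

  IsTree : Set
  IsTree = Connected × Acyclic

infix 4 _⊑_
_⊑_ : ∀ {n} {W W′ : Subset n} → Graph W → Graph W′ → Set
_⊑_ {W = W} {W′} H G = W ⊆ W′ × (∀ {u v} → Adj H u v → Adj G u v)

infix 8 _[_]
_[_] : ∀ {n} → Graph {n} ⊤ → (U : Subset n) → Graph U
G [ U ] = record
  { Adj        = λ u v → u ∈ U × v ∈ U × Adj G u v
  ; adj?       = λ u v → (u ∈? U) ×-dec (v ∈? U) ×-dec adj? G u v
  ; adj-sym    = λ { (u∈ , v∈ , e) → v∈ , u∈ , adj-sym G e }
  ; adj-irrefl = λ { eq (_ , _ , e) → adj-irrefl G eq e }
  ; adj-in     = λ { (u∈ , _) → u∈ }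
  }

unionGraph : ∀ {n m} {W : Fin m → Subset n} (T : ∀ i → Graph (W i)) →
             Graph ⟦ (λ v → any? (λ i → v ∈? W i)) ⟧
unionGraph {W = W} T = record
  { Adj        = λ u v → ∃[ i ] Adj (T i) u v
  ; adj?       = λ u v → any? (λ i → adj? (T i) u v)
  ; adj-sym    = λ { (i , e) → i , adj-sym (T i) e }
  ; adj-irrefl = λ { eq (i , e) → adj-irrefl (T i) eq e }
  ; adj-in     = λ { (i , e) → ∈-⟦⟧⁺ (λ v → any? (λ i → v ∈? W i)) (i , adj-in (T i) e) }
  }

outerNeighbours : ∀ {n} → Graph {n} ⊤ → Subset n → Subset n
outerNeighbours G U =
  ⟦ (λ v → ¬? (v ∈? U) ×-dec any? (λ u → (u ∈? U) ×-dec adj? G u v)) ⟧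

------------------------------------------------------------------------
-- Rooted trees

-- Parent-pointer presentation.  Reachability of the parentless root from
-- every node rules out directed cycles.
record RootedTree (m : ℕ) : Set where
  field
    root        : Fin m
    parent      : Fin m → Maybe (Fin m)
    parent-root : parent root ≡ nothing

  _childOf_ : Fin m → Fin m → Set
  x childOf y = parent x ≡ just y

  infix 4 _≼_ _≺_
  _≼_ : Fin m → Fin m → Set
  _≼_ = Star _childOf_

  _≺_ : Fin m → Fin m → Set
  _≺_ = TransClosure _childOf_

  field
    toRoot : ∀ x → x ≼ root

  depth : Fin m → ℕ
  depth x = fold (λ _ _ → ℕ) (λ _ → suc) 0 (toRoot x)

  -- Counted in edges.
  height : ℕ
  height = foldr _⊔_ 0 (map depth (allFin m))

  infix 4 _≼?_
  _≼?_ : Decidable _≼_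
  x ≼? y = go (toRoot x)
    where
    step : ∀ {x z} → x childOf z → x ≢ y → x ≼ y → z ≼ y
    step p x≢y ε = contradiction refl x≢y
    step p x≢y (q ◅ qs) with refl ← trans (sym p) q = qs

    root-top : root ≢ y → ¬ (root ≼ y)
    root-top root≢y ε = root≢y refl
    root-top root≢y (q ◅ _) with () ← trans (sym parent-root) q

    go : ∀ {x} → x ≼ root → Dec (x ≼ y)
    go {x} r with x ≟ y
    go r       | yes refl = yes ε
    go ε       | no x≢y = no (root-top x≢y)
    go (p ◅ r) | no x≢y = map′ (p ◅_) (step p x≢y) (go r)

------------------------------------------------------------------------
-- Hierarchies

-- A partition of Fin n into nonempty classes, labelled by Fin m, together with
-- a rooted tree on the classes.
record Hierarchy (n : ℕ) : Set where
  field
    {m}      : ℕ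
    cls      : Fin n → Fin m
    cls-surj : Surjective _≡_ _≡_ cls
    tree     : RootedTree m

  open RootedTree tree public

  part : Fin m → Subset n
  part γ = ⟦ (λ v → cls v ≟ γ) ⟧

  -- V(H_γ)
  below : Fin m → Subset n
  below γ = ⟦ (λ v → cls v ≼? γ) ⟧

open Hierarchy using (m; cls; part; below) public

-- The properties of a base hierarchy that its coarsenings inherit.  For a base
-- hierarchy, child-edge already follows from the two preceding fields.
record IsHierarchyOf {n : ℕ} (G : Graph {n} ⊤) (H : Hierarchy n) : Set where
  open Hierarchy H hiding (m; cls; part; below)
  field
    height-bound    : height ≤ 1 ·log₂ n
    edge-comparable : ∀ {u v} → Adj G u v → (cls H u ≺ cls H v) ⊎ (cls H v ≼ cls H u)
    below-connected : ∀ γ → Connected (G [ below H γ ])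
    child-edge      : ∀ {γ γ′} → γ′ childOf γ →
                      ∃[ u ] ∃[ v ] (u ∈ part H γ × v ∈ below H γ′ × Adj G u v)

record IsBaseHierarchy {n : ℕ} (G : Graph {n} ⊤) (H : Hierarchy n) : Set₁ where
  field
    isHierarchyOf : IsHierarchyOf G H
    W⁰            : Fin (m H) → Subset n
    T⁰            : ∀ γ → Graph (W⁰ γ)
    T⁰-tree       : ∀ γ → IsTree (T⁰ γ)
    T⁰-subgraph   : ∀ γ → T⁰ γ ⊑ G
    T⁰-spans      : ∀ γ → part H γ ⊆ W⁰ γ
    T⁰-degree     : ∀ γ v → degree (T⁰ γ) v ≤ 4
    T∪-degree     : ∀ v → degree (unionGraph T⁰) v ≤ 2 ·log₂ n

-- H arises from H⁰ by contracting connected subtrees of H⁰: the fibres of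
-- `merge` are the node sets being contracted.
record Coarsening {n : ℕ} (H⁰ H : Hierarchy n) : Set where
  private
    module H⁰ = Hierarchy H⁰
    module H  = Hierarchy H
  field
    merge           : Fin (m H⁰) → Fin (m H)
    merge-surj      : Surjective _≡_ _≡_ merge
    fibre-connected : ∀ {γ δ} → merge γ ≡ merge δ →
                      Star (λ x y → merge x ≡ merge γ × merge y ≡ merge γ ×
                                    SymClosure H⁰._childOf_ x y) γ δ
    cls-merge       : ∀ v → cls H v ≡ merge (cls H⁰ v)
    root-merge      : H.root ≡ merge H⁰.root
    childOf-merge   : ∀ {K′ K} → (K′ H.childOf K) ⇔
                      (K′ ≢ K × ∃[ γ′ ] ∃[ γ ] (merge γ′ ≡ K′ × merge γ ≡ K × γ′ H⁰.childOf γ))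

-- T spans G[U] because its index makes U its vertex set.
IsSpanningTree : ∀ {n} (G : Graph {n} ⊤) (U : Subset n) → Graph U → Set
IsSpanningTree G U T = IsTree T × T ⊑ G [ U ]

{-# OPTIONS --safe #-}
module Submission where

-- Colour the vertices with f + 1 colours so that every colour occurs on every
-- N(H⁰_γ) with more than 2 f log n elements; conditional expectations find such
-- a colouring, because (1 + 1/f)^f ≥ 2.  Fix a colour class S and let R be the
-- set of nodes a such that some edge leaving V(H⁰_a) belongs to T∪ or ends in S.
-- A coarsening that merges every node of R with its parent has subtrees whose
-- outer neighbours avoid S, hence are few.
--
-- To make the merged components connected, each merged node a gets one
-- connecting edge.  For a ∉ R it is an edge from the parent of a to a vertex y
-- of V(H⁰_a), and all nodes between y and a are merged as well.  For a ∈ R,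
-- treated deepest first, the vertices already merged with a are connected
-- either to a or to something above a.  If a itself is not connected to
-- something above it, an edge from below a into S above a, or a walk in
-- V(H⁰_a) from a to a vertex that is connected above, provides an edge that
-- does the job, possibly after merging one more branch.  Charging edges to the
-- nodes that caused them, a vertex outside S is charged at most once by each
-- non-root node on the path from its own node to the root, so it meets at most
-- height ≤ log n connecting edges besides the 2 log n edges of T∪.

open import Defs
open import Data.Bool using (if_then_else_)
open import Data.Fin using (Fin; zero; suc; toℕ; fromℕ<)
import Data.Fin.Properties as Finₚ
open import Data.Fin.Subset using (Subset; _∈_; _∉_; _⊆_; _∪_; ⊤; inside; outside; ∣_∣)
open import Data.Fin.Subset.Properties using (_∈?_; p⊆q⇒∣p∣≤∣q∣; p⊂q⇒∣p∣<∣q∣; ∣⊤∣≡n; x∈p∪q⁺; ⊆⊤; ∈⊤)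
open import Data.List using (List; _∷_; []; _∷ʳ_; length; map; foldr; filter; allFin; cartesianProduct)
open import Data.List.Membership.Propositional using () renaming (_∈_ to _∈ˡ_)
open import Data.List.Membership.Propositional.Properties using (∈-allFin; ∈-map⁺; ∈-filter⁺; ∈-filter⁻; ∈-cartesianProduct⁺; ∈-cartesianProduct⁻)
open import Data.List.Properties using (length-++; length-map; length-filter; length-tabulate)
import Data.List.Relation.Unary.All as All
open import Data.List.Relation.Unary.All using (All; []; _∷_)
open import Data.List.Relation.Unary.AllPairs using (_∷_)
open import Data.List.Relation.Unary.Any using (here; there)
open import Data.List.Relation.Unary.Linked using (Linked; [-]; _∷_)
open import Data.Maybe using (Maybe; just; nothing) renaming (map to mapᵐ)
open import Data.Maybe.Properties using (just-injective)
open import Data.Nat using (ℕ; zero; suc; pred; _≤_; _<_; _+_; _*_; _^_; _⊔_; s≤s; z≤n; NonZero; >-nonZero)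
open import Data.Nat.Induction using (<-wellFounded)
import Data.Nat.Properties as ℕₚ
open import Data.Nat.Tactic.RingSolver using (solve-∀)
open import Data.Product using (Σ-syntax; ∃-syntax; _×_; _,_; proj₁; proj₂)
open import Data.Sum using (_⊎_; inj₁; inj₂; [_,_]′)
open import Data.Unit using (tt)
open import Data.Vec using (_∷_; []; here; there)
open import Data.Vec.Properties using (lookup∘tabulate; []=⇒lookup)
open import Function using (_∘_; id; mk⇔)
open import Induction.WellFounded using (Acc; acc)
open import Relation.Binary.Construct.Closure.ReflexiveTransitive using (Star; ε; _◅_; _◅◅_; fold; gmap; reverse; kleisliStar)
open import Relation.Binary.Construct.Closure.Symmetric using (SymClosure; fwd)
import Relation.Binary.Construct.Closure.Symmetric as Sym
open import Relation.Binary.Construct.Closure.Transitive using () renaming ([_] to [_]⁺; _∷_ to _∷⁺_)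
open import Relation.Binary.Definitions using (Decidable)
open import Relation.Binary.PropositionalEquality hiding ([_])
open import Relation.Nullary using (¬_; Dec; yes; no; does; contradiction)
open import Relation.Nullary.Decidable using (_×-dec_; _⊎-dec_; ¬?; map′)
import Relation.Unary as U
open import Algebra.Properties.CommutativeMonoid.Sum ℕₚ.+-0-commutativeMonoid using (sum; sum-cong-≗; ∑-distrib-+)


-- Reachability in a finite digraph (Warshall): Via k u v allows only
-- intermediate vertices with index below k.
module _ {n : ℕ} {R : Fin n → Fin n → Set} (R? : Decidable R) where

  private
    Via : ℕ → Fin n → Fin n → Set
    Via zero    u v = u ≡ v ⊎ R u v
    Via (suc k) u v = Via k u v ⊎ ∃[ w ] (toℕ w ≡ k × Via k u w × Via k w v)

    via? : ∀ k → Decidable (Via k)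
    via? zero    u v = (u Finₚ.≟ v) ⊎-dec R? u v
    via? (suc k) u v =
      via? k u v ⊎-dec Finₚ.any? (λ w → (toℕ w ℕₚ.≟ k) ×-dec via? k u w ×-dec via? k w v)

    via⇒star : ∀ k {u v} → Via k u v → Star R u v
    via⇒star zero    (inj₁ refl)            = ε
    via⇒star zero    (inj₂ r)               = r ◅ ε
    via⇒star (suc k) (inj₁ p)               = via⇒star k p
    via⇒star (suc k) (inj₂ (_ , _ , p , q)) = via⇒star k p ◅◅ via⇒star k q

    -- A path from vertex `k` that passes through `k` again can be replaced by its part after that
    -- visit.
    via-from : ∀ k {u w} → toℕ w ≡ k → Via (suc k) w u → Via k w u
    via-from k w≡k (inj₁ p) = p
    via-from k w≡k (inj₂ (_ , w′≡k , _ , q)) with refl ← Finₚ.toℕ-injective (trans w≡k (sym w′≡k)) = q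

    via-to : ∀ k {u w} → toℕ w ≡ k → Via (suc k) u w → Via k u w
    via-to k w≡k (inj₁ p) = p
    via-to k w≡k (inj₂ (_ , w′≡k , p , _)) with refl ← Finₚ.toℕ-injective (trans w≡k (sym w′≡k)) = p

    via-trans : ∀ k {u v w} → toℕ w < k → Via k u w → Via k w v → Via k u v
    via-trans (suc k) {w = w} (s≤s w≤k) p q with ℕₚ.m≤n⇒m<n∨m≡n w≤k
    ... | inj₂ w≡k = inj₂ (w , w≡k , via-to k w≡k p , via-from k w≡k q)
    ... | inj₁ w<k with p | q
    ...   | inj₁ p₁ | inj₁ q₁ = inj₁ (via-trans k w<k p₁ q₁)
    ...   | inj₁ p₁ | inj₂ (x , e , q₁ , q₂) = inj₂ (x , e , via-trans k w<k p₁ q₁ , q₂)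
    ...   | inj₂ (x , e , p₁ , p₂) | inj₁ q₁ = inj₂ (x , e , p₁ , via-trans k w<k p₂ q₁)
    ...   | inj₂ (x , e , p₁ , _) | inj₂ (y , e′ , _ , q₂)
            with refl ← Finₚ.toℕ-injective (trans e (sym e′)) = inj₂ (x , e , p₁ , q₂)

    via-step : ∀ k {u v} → u ≡ v ⊎ R u v → Via k u v
    via-step zero    p = p
    via-step (suc k) p = inj₁ (via-step k p)

    star⇒via : ∀ {u v} → Star R u v → Via n u v
    star⇒via ε        = via-step n (inj₁ refl)
    star⇒via (r ◅ rs) = via-trans n (Finₚ.toℕ<n _) (via-step n (inj₂ r)) (star⇒via rs)

  star? : Decidable (Star R)
  star? u v = map′ (via⇒star n) star⇒via (via? n u v)

-- Finite subsets, their cardinalities and outer neighbours.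

∈-⟦⟧⁻ : ∀ {n} {P : Fin n → Set} (P? : U.Decidable P) {x : Fin n} → x ∈ ⟦ P? ⟧ → P x
∈-⟦⟧⁻ P? {x} x∈
  with P? x | trans (sym (lookup∘tabulate (λ y → does (P? y)) x)) ([]=⇒lookup x∈)
... | yes px | _ = px

nth : ∀ {n} (p : Subset n) → Fin ∣ p ∣ → Fin n
nth (inside  ∷ p) zero    = zero
nth (inside  ∷ p) (suc i) = suc (nth p i)
nth (outside ∷ p) i       = suc (nth p i)

nth-∈ : ∀ {n} (p : Subset n) i → nth p i ∈ p
nth-∈ (inside  ∷ p) zero    = here
nth-∈ (inside  ∷ p) (suc i) = there (nth-∈ p i)
nth-∈ (outside ∷ p) i       = there (nth-∈ p i)

nth-injective : ∀ {n} (p : Subset n) {i j} → nth p i ≡ nth p j → i ≡ j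
nth-injective (inside  ∷ p) {zero}  {zero}  eq = refl
nth-injective (inside  ∷ p) {suc i} {suc j} eq = cong suc (nth-injective p (Finₚ.suc-injective eq))
nth-injective (outside ∷ p) eq = nth-injective p (Finₚ.suc-injective eq)

rank : ∀ {n} {p : Subset n} {x} → x ∈ p → Fin ∣ p ∣
rank {p = inside  ∷ p} here       = zero
rank {p = inside  ∷ p} (there x∈) = suc (rank x∈)
rank {p = outside ∷ p} (there x∈) = rank x∈

nth-rank : ∀ {n} {p : Subset n} {x} (x∈ : x ∈ p) → nth p (rank x∈) ≡ x
nth-rank {p = inside  ∷ p} here       = refl
nth-rank {p = inside  ∷ p} (there x∈) = cong suc (nth-rank x∈)
nth-rank {p = outside ∷ p} (there x∈) = cong suc (nth-rank x∈)

-- `f` may depend on the membership proof: in `extra-degree` the slot is computed from the charge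
-- that this proof yields.
∣p∣≤-injection : ∀ {n k} (p : Subset n) (f : ∀ {x} → x ∈ p → Fin k) →
                 (∀ {x y} (x∈ : x ∈ p) (y∈ : y ∈ p) → f x∈ ≡ f y∈ → x ≡ y) → ∣ p ∣ ≤ k
∣p∣≤-injection p f inj =
  Finₚ.injective⇒≤ {f = λ i → f (nth-∈ p i)}
    (λ {i} {j} eq → nth-injective p (inj (nth-∈ p i) (nth-∈ p j) eq))

∣p∪q∣≤∣p∣+∣q∣ : ∀ {n} (p q : Subset n) → ∣ p ∪ q ∣ ≤ ∣ p ∣ + ∣ q ∣
∣p∪q∣≤∣p∣+∣q∣ []            []            = z≤n
∣p∪q∣≤∣p∣+∣q∣ (outside ∷ p) (outside ∷ q) = ∣p∪q∣≤∣p∣+∣q∣ p q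
∣p∪q∣≤∣p∣+∣q∣ (outside ∷ p) (inside  ∷ q) =
  ℕₚ.≤-trans (s≤s (∣p∪q∣≤∣p∣+∣q∣ p q)) (ℕₚ.≤-reflexive (sym (ℕₚ.+-suc ∣ p ∣ ∣ q ∣)))
∣p∪q∣≤∣p∣+∣q∣ (inside  ∷ p) (outside ∷ q) = s≤s (∣p∪q∣≤∣p∣+∣q∣ p q)
∣p∪q∣≤∣p∣+∣q∣ (inside  ∷ p) (inside  ∷ q) =
  s≤s (ℕₚ.≤-trans (∣p∪q∣≤∣p∣+∣q∣ p q) (ℕₚ.+-monoʳ-≤ ∣ p ∣ (ℕₚ.n≤1+n ∣ q ∣)))

OuterNeighbour : ∀ {n} → Graph {n} ⊤ → Subset n → Fin n → Set
OuterNeighbour G U v = v ∉ U × ∃[ u ] (u ∈ U × Adj G u v)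

∈-outer⁺ : ∀ {n} (G : Graph {n} ⊤) U {v} → OuterNeighbour G U v → v ∈ outerNeighbours G U
∈-outer⁺ G U = ∈-⟦⟧⁺ (λ v → ¬? (v ∈? U) ×-dec Finₚ.any? (λ u → (u ∈? U) ×-dec adj? G u v))

∈-outer⁻ : ∀ {n} (G : Graph {n} ⊤) U {v} → v ∈ outerNeighbours G U → OuterNeighbour G U v
∈-outer⁻ G U = ∈-⟦⟧⁻ (λ v → ¬? (v ∈? U) ×-dec Finₚ.any? (λ u → (u ∈? U) ×-dec adj? G u v))

outerNeighbours-cong : ∀ {n} (G : Graph {n} ⊤) {U U′ : Subset n} → U ⊆ U′ → U′ ⊆ U →
                       outerNeighbours G U ⊆ outerNeighbours G U′
outerNeighbours-cong G U⊆U′ U′⊆U v∈ =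
  let v∉ , u , u∈ , e = ∈-outer⁻ G _ v∈ in ∈-outer⁺ G _ ((λ v∈′ → v∉ (U′⊆U v∈′)) , u , U⊆U′ u∈ , e)

-- Order, depth and induction in rooted trees.

module TreeProperties {m : ℕ} (T : RootedTree m) where
  open RootedTree T

  infix 4 _⊏_
  -- The relation `_≺_` with the parent of the lower node exposed, followed by a plain `_≼_`.
  _⊏_ : Fin m → Fin m → Set
  x ⊏ y = ∃[ p ] (x childOf p × p ≼ y)

  len : ∀ {x y} → x ≼ y → ℕ
  len = fold (λ _ _ → ℕ) (λ _ → suc) 0

  ⊏⇒≼ : ∀ {x y} → x ⊏ y → x ≼ y
  ⊏⇒≼ (_ , c , r) = c ◅ r

  ⊏-≼-trans : ∀ {x y z} → x ⊏ y → y ≼ z → x ⊏ z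
  ⊏-≼-trans (p , c , r) q = p , c , r ◅◅ q

  ≼-⊏-trans : ∀ {x y z} → x ≼ y → y ⊏ z → x ⊏ z
  ≼-⊏-trans ε        q = q
  ≼-⊏-trans (c ◅ r) q = _ , c , r ◅◅ ⊏⇒≼ q

  ≼-split : ∀ {x y} → x ≼ y → x ≡ y ⊎ x ⊏ y
  ≼-split ε       = inj₁ refl
  ≼-split (c ◅ r) = inj₂ (_ , c , r)

  ⊏⇒≺ : ∀ {x y} → x ⊏ y → x ≺ y
  ⊏⇒≺ (_ , c , r) = go c r
    where
    go : ∀ {x p y} → x childOf p → p ≼ y → x ≺ y
    go c ε        = [ c ]⁺
    go c (d ◅ r) = c ∷⁺ go d r

  ≺⇒⊏ : ∀ {x y} → x ≺ y → x ⊏ y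
  ≺⇒⊏ [ c ]⁺   = _ , c , ε
  ≺⇒⊏ (c ∷⁺ r) = _ , c , ⊏⇒≼ (≺⇒⊏ r)

  childOf-unique : ∀ {x p q} → x childOf p → x childOf q → p ≡ q
  childOf-unique c d = just-injective (trans (sym c) d)

  root-no-parent : ∀ {y} → ¬ (root childOf y)
  root-no-parent c with () ← trans (sym parent-root) c

  root-⋤ : ∀ {y} → ¬ (root ⊏ y)
  root-⋤ (_ , c , _) = root-no-parent c

  -- Parents are unique and the root has none, so only one path leads up to the root. Hence `depth`,
  -- read off `toRoot`, can be computed along any path.
  len-toRoot : ∀ {x} (p q : x ≼ root) → len p ≡ len q
  len-toRoot ε       ε       = refl
  len-toRoot ε       (d ◅ _) = contradiction d root-no-parent
  len-toRoot (c ◅ _) ε       = contradiction c root-no-parent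
  len-toRoot (c ◅ p) (d ◅ q) with refl ← childOf-unique c d = cong suc (len-toRoot p q)

  depth-childOf : ∀ {x y} → x childOf y → depth x ≡ suc (depth y)
  depth-childOf {x} {y} c = len-toRoot (toRoot x) (c ◅ toRoot y)

  depth-≼ : ∀ {x y} → x ≼ y → depth y ≤ depth x
  depth-≼ ε       = ℕₚ.≤-refl
  depth-≼ (c ◅ r) = ℕₚ.≤-trans (depth-≼ r) (ℕₚ.≤-trans (ℕₚ.n≤1+n _) (ℕₚ.≤-reflexive (sym (depth-childOf c))))

  depth-⊏ : ∀ {x y} → x ⊏ y → depth y < depth x
  depth-⊏ (_ , c , r) = ℕₚ.≤-trans (s≤s (depth-≼ r)) (ℕₚ.≤-reflexive (sym (depth-childOf c)))

  ⊏-irrefl : ∀ {x} → ¬ (x ⊏ x)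
  ⊏-irrefl x⊏x = ℕₚ.<-irrefl refl (depth-⊏ x⊏x)

  ⊏⇒⋠ : ∀ {x y} → x ⊏ y → ¬ (y ≼ x)
  ⊏⇒⋠ x⊏y y≼x = ⊏-irrefl (⊏-≼-trans x⊏y y≼x)

  -- Parents are unique, so of two upward paths from `x` one is an initial segment of the other.
  ancestors-comparable : ∀ {x y z} → x ≼ y → x ≼ z → y ≼ z ⊎ z ⊏ y
  ancestors-comparable ε       q       = inj₁ q
  ancestors-comparable (c ◅ p) ε       = inj₂ (_ , c , p)
  ancestors-comparable (c ◅ p) (d ◅ q) with refl ← childOf-unique c d = ancestors-comparable p q

  childOf-≼⇒≡ : ∀ {x y p} → x childOf p → y childOf p → x ≼ y → x ≡ y
  childOf-≼⇒≡ c d ε = refl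
  childOf-≼⇒≡ c d (c′ ◅ r) with refl ← childOf-unique c c′ = contradiction r (⊏⇒⋠ (_ , d , ε))

  _⊏?_ : Decidable _⊏_
  x ⊏? y = map′ (λ (p≼ , x≢y) → strict p≼ x≢y) (λ p → ⊏⇒≼ p , λ { refl → ⊏-irrefl p })
              ((x ≼? y) ×-dec ¬? (x Finₚ.≟ y))
    where
    strict : ∀ {x y} → x ≼ y → x ≢ y → x ⊏ y
    strict p x≢y with ≼-split p
    ... | inj₁ eq  = contradiction eq x≢y
    ... | inj₂ x⊏y = x⊏y

  depth≤height : ∀ x → depth x ≤ height
  depth≤height x = go (allFin m) (∈-allFin x)
    where
    go : ∀ xs → x ∈ˡ xs → depth x ≤ foldr _⊔_ 0 (map depth xs)
    go (_ ∷ xs) (here refl) = ℕₚ.m≤m⊔n _ _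
    go (_ ∷ xs) (there x∈)  = ℕₚ.≤-trans (go xs x∈) (ℕₚ.m≤n⊔m _ _)

  height≤ : ∀ {k} → (∀ x → depth x ≤ k) → height ≤ k
  height≤ {k} bound = go (allFin m)
    where
    go : ∀ xs → foldr _⊔_ 0 (map depth xs) ≤ k
    go []       = z≤n
    go (x ∷ xs) = ℕₚ.⊔-lub (bound x) (go xs)

  -- Induction from the leaves upwards. Each step down lowers the fuel by one and raises the depth
  -- by at least one, which keeps `height < k + depth d`.
  ⊏-rec : (P : Fin m → Set) → (∀ d → (∀ {γ} → γ ⊏ d → P γ) → P d) → ∀ d → P d
  ⊏-rec P step d = go (suc height) d (ℕₚ.m≤m+n _ _)
    where
    go : ∀ k d → height < k + depth d → P d
    go zero    d lt = contradiction (depth≤height d) (ℕₚ.<⇒≱ lt)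
    go (suc k) d lt = step d λ {γ} γ⊏d → go k γ
      (ℕₚ.≤-trans lt (ℕₚ.≤-trans (ℕₚ.≤-reflexive (sym (ℕₚ.+-suc k (depth d)))) (ℕₚ.+-monoʳ-≤ k (depth-⊏ γ⊏d))))

  ancestor-depth-injective : ∀ {x y z} → x ≼ y → x ≼ z → depth y ≡ depth z → y ≡ z
  ancestor-depth-injective p q eq with ancestors-comparable p q
  ... | inj₂ z⊏y = contradiction eq (ℕₚ.<⇒≢ (depth-⊏ z⊏y))
  ... | inj₁ y≼z with ≼-split y≼z
  ...   | inj₁ y≡z = y≡z
  ...   | inj₂ y⊏z = contradiction (sym eq) (ℕₚ.<⇒≢ (depth-⊏ y⊏z))

-- Spanning trees

module _ {n : ℕ} {W : Subset n} where

  infix 4 _⊆ᴱ_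
  _⊆ᴱ_ : Graph W → Graph W → Set
  A ⊆ᴱ B = ∀ {u v} → Adj A u v → Adj B u v

  SamePair : Fin n × Fin n → Fin n → Fin n → Set
  SamePair (a , b) u v = (u ≡ a × v ≡ b) ⊎ (u ≡ b × v ≡ a)

  infixl 7 _∖ᴱ_
  _∖ᴱ_ : Graph W → Fin n × Fin n → Graph W
  A ∖ᴱ (a , b) = record
    { Adj        = λ u v → Adj A u v × ¬ SamePair (a , b) u v
    ; adj?       = λ u v → adj? A u v ×-dec
                     ¬? (((u Finₚ.≟ a) ×-dec (v Finₚ.≟ b)) ⊎-dec ((u Finₚ.≟ b) ×-dec (v Finₚ.≟ a)))
    ; adj-sym    = λ { (e , ≢) → adj-sym A e , λ { (inj₁ (p , q)) → ≢ (inj₂ (q , p))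
                                                  ; (inj₂ (p , q)) → ≢ (inj₁ (q , p)) } }
    ; adj-irrefl = λ { eq (e , _) → adj-irrefl A eq e }
    ; adj-in     = λ { (e , _) → adj-in A e }
    }

  Removable : Graph W → Fin n × Fin n → Set
  Removable A (a , b) = Adj A a b × Star (Adj (A ∖ᴱ (a , b))) a b

  removable? : ∀ A e → Dec (Removable A e)
  removable? A (a , b) = adj? A a b ×-dec star? (adj? (A ∖ᴱ (a , b))) a b

  removable-mono : ∀ {A B} → A ⊆ᴱ B → ∀ e → Removable A e → Removable B e
  removable-mono A⊆B (a , b) (e , p) = A⊆B e , gmap id (λ { (x , ≢) → A⊆B x , ≢ }) p

  ∖ᴱ-connected : ∀ A e → Connected A → Removable A e → Connected (A ∖ᴱ e)
  ∖ᴱ-connected A (a , b) conn (_ , detour) u∈ v∈ = kleisliStar id replace (conn u∈ v∈)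
    where
    replace : ∀ {u v} → Adj A u v → Star (Adj (A ∖ᴱ (a , b))) u v
    replace {u} {v} e with ((u Finₚ.≟ a) ×-dec (v Finₚ.≟ b)) ⊎-dec ((u Finₚ.≟ b) ×-dec (v Finₚ.≟ a))
    ... | yes (inj₁ (refl , refl)) = detour
    ... | yes (inj₂ (refl , refl)) = reverse (adj-sym (A ∖ᴱ (a , b))) detour
    ... | no ≢ = (e , ≢) ◅ ε

  -- One pass is enough: deleting further edges only destroys detours, so an edge found irremovable
  -- stays so.
  prune : ∀ (es : List (Fin n × Fin n)) A → Connected A →
          Σ[ T ∈ Graph W ] (Connected T × T ⊆ᴱ A × All (¬_ ∘ Removable T) es)
  prune [] A conn = A , conn , id , []
  prune (e ∷ es) A conn with T , Tconn , T⊆A , irr ← prune es A conn | removable? T e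
  ... | no ¬r = T , Tconn , T⊆A , ¬r ∷ irr
  ... | yes r = T ∖ᴱ e , ∖ᴱ-connected T e Tconn r , T⊆A ∘ proj₁ ,
                (λ { ((_ , ≢) , _) → ≢ (inj₁ (refl , refl)) }) ∷
                All.map (λ {e′} ¬r r′ → ¬r (removable-mono {T ∖ᴱ e} {T} proj₁ e′ r′)) irr

  -- Going around a cycle the other way makes its first edge removable.
  irremovable⇒acyclic : ∀ T → (∀ e → ¬ Removable T e) → Acyclic T
  irremovable⇒acyclic T irr x (_ ∷ []) (s≤s () , _)
  irremovable⇒acyclic T irr x (y ∷ z ∷ zs)
    (_ , (_ ∷ x≢z ∷ x≢zs) ∷ (y≢z ∷ y≢zs) ∷ _ , xy ∷ yz ∷ rest) =
    irr (x , y) (xy , reverse (adj-sym (T ∖ᴱ (x , y)))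
      ((yz , (λ { (inj₁ (_ , eq)) → y≢z (sym eq) ; (inj₂ (_ , eq)) → x≢z (sym eq) })) ◅
       around z zs (x≢z ∷ x≢zs) (y≢z ∷ y≢zs) rest))
    where
    avoid : ∀ {u v} → x ≢ u → y ≢ u → ¬ SamePair (x , y) u v
    avoid x≢ y≢ (inj₁ (eq , _)) = x≢ (sym eq)
    avoid x≢ y≢ (inj₂ (eq , _)) = y≢ (sym eq)

    around : ∀ u us → All (x ≢_) (u ∷ us) → All (y ≢_) (u ∷ us) →
             Linked (Adj T) (u ∷ us ∷ʳ x) → Star (Adj (T ∖ᴱ (x , y))) u x
    around u []       (x≢ ∷ _)  (y≢ ∷ _)  (e ∷ [-]) = (e , avoid x≢ y≢) ◅ ε
    around u (v ∷ vs) (x≢ ∷ x≢s) (y≢ ∷ y≢s) (e ∷ es) = (e , avoid x≢ y≢) ◅ around v vs x≢s y≢s es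

  spanningTree : ∀ A → Connected A → Σ[ T ∈ Graph W ] (IsTree T × T ⊆ᴱ A)
  spanningTree A conn
    with T , Tconn , T⊆A , irr ← prune (cartesianProduct (allFin n) (allFin n)) A conn =
    T , (Tconn , irremovable⇒acyclic T
      (λ (a , b) → All.lookup irr (∈-cartesianProduct⁺ (∈-allFin a) (∈-allFin b)))) , T⊆A

-- Colourings hitting every large set

sum-const : ∀ k w → sum {k} (λ _ → w) ≡ k * w
sum-const zero    w = refl
sum-const (suc k) w = cong (w +_) (sum-const k w)

sum-omit : ∀ {k} (i : Fin (suc k)) w → sum (λ c → if does (c Finₚ.≟ i) then 0 else w) ≡ k * w
sum-omit {k}     zero    w = sum-const k w
sum-omit {suc k} (suc i) w = cong (w +_) (sum-omit i w)

sum-<⇒∃-< : ∀ {k} (g : Fin k → ℕ) b → sum g < k * b → ∃[ c ] g c < b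
sum-<⇒∃-< {suc k} g b Σ< with g zero ℕₚ.<? b
... | yes lt = zero , lt
... | no ≮b with c , lt ← sum-<⇒∃-< (g ∘ suc) b
                   (ℕₚ.+-cancelˡ-< b _ _ (ℕₚ.≤-<-trans (ℕₚ.+-monoˡ-≤ _ (ℕₚ.≮⇒≥ ≮b)) Σ<)) = suc c , lt

-- Derandomisation by conditional expectations.  A requirement (A , i) asks
-- that the colour i occur on A; weight A is the number of colourings of Fin n
-- with f + 1 colours for which it fails.
module Colouring (f : ℕ) where

  q : ℕ
  q = suc f

  Requirement : ℕ → Set
  Requirement n = Subset n × Fin q

  weight : ∀ {n} → Subset n → ℕ
  weight []            = 1
  weight (inside  ∷ A) = f * weight A
  weight (outside ∷ A) = q * weight A

  total : ∀ {n} → List (Requirement n) → ℕ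
  total []            = 0
  total ((A , _) ∷ L) = weight A + total L

  Met : ∀ {n} → (Fin n → Fin q) → Requirement n → Set
  Met col (A , i) = ∃[ v ] (v ∈ A × col v ≡ i)

  pending : ∀ {n} → Fin q → List (Requirement (suc n)) → List (Requirement n)
  pending c []                      = []
  pending c ((outside ∷ A , i) ∷ L) = (A , i) ∷ pending c L
  pending c ((inside  ∷ A , i) ∷ L) =
    if does (c Finₚ.≟ i) then pending c L else (A , i) ∷ pending c L

  extend : ∀ {n} → Fin q → (Fin n → Fin q) → Fin (suc n) → Fin q
  extend c col zero    = c
  extend c col (suc v) = col v

  met-extend : ∀ {n} c (col : Fin n → Fin q) {b A i} → Met col (A , i) → Met (extend c col) (b ∷ A , i)
  met-extend c col (v , v∈ , eq) = suc v , there v∈ , eq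

  all-met-extend : ∀ {n} c (col : Fin n → Fin q) L → All (Met col) (pending c L) → All (Met (extend c col)) L
  all-met-extend c col []                      _        = []
  all-met-extend c col ((outside ∷ A , i) ∷ L) (p ∷ ps) = met-extend c col p ∷ all-met-extend c col L ps
  all-met-extend c col ((inside  ∷ A , i) ∷ L) ps with c Finₚ.≟ i
  all-met-extend c col ((inside  ∷ A , i) ∷ L) ps       | yes c≡i =
    (zero , here , c≡i) ∷ all-met-extend c col L ps
  all-met-extend c col ((inside  ∷ A , i) ∷ L) (p ∷ ps) | no _ =
    met-extend c col p ∷ all-met-extend c col L ps

  -- A set without the first vertex survives for all `q` colours of that vertex, a set containing it
  -- for the `f` colours other than `i`; these are the factors in `weight`.
  pending-weight : ∀ {n} (L : List (Requirement (suc n))) → sum (λ c → total (pending c L)) ≡ total L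
  pending-weight [] = trans (sum-const q 0) (ℕₚ.*-zeroʳ q)
  pending-weight ((outside ∷ A , i) ∷ L) =
    trans (∑-distrib-+ (λ _ → weight A) (λ c → total (pending c L)))
          (cong₂ _+_ (sum-const q (weight A)) (pending-weight L))
  pending-weight ((inside ∷ A , i) ∷ L) =
    trans (sum-cong-≗ split)
    (trans (∑-distrib-+ (λ c → if does (c Finₚ.≟ i) then 0 else weight A) (λ c → total (pending c L)))
           (cong₂ _+_ (sum-omit i (weight A)) (pending-weight L)))
    where
    split : ∀ c → total (pending c ((inside ∷ A , i) ∷ L)) ≡
                  (if does (c Finₚ.≟ i) then 0 else weight A) + total (pending c L)
    split c with c Finₚ.≟ i
    ... | yes _ = refl
    ... | no _  = refl

  -- Some colour of the first vertex leaves a total below the average, so the bound is kept. With no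
  -- vertices left the total is below 1, so no requirement remains.
  colouring : ∀ n (L : List (Requirement n)) → total L < q ^ n → ∃[ col ] All (Met {n} col) L
  colouring zero [] _ = (λ ()) , []
  colouring zero (([] , _) ∷ _) (s≤s ())
  colouring (suc n) L lt
    with c , lt′ ← sum-<⇒∃-< (λ c → total (pending c L)) (q ^ n)
                     (subst (_< q ^ suc n) (sym (pending-weight L)) lt)
    with col , met ← colouring n (pending c L) lt′ =
    extend c col , all-met-extend c col L met

  -- The formula `f ^ ∣ A ∣ * q ^ (n - ∣ A ∣)` for the weight, cleared of the subtraction.
  weight-power : ∀ {n} (A : Subset n) → weight A * q ^ ∣ A ∣ ≡ f ^ ∣ A ∣ * q ^ n
  weight-power [] = refl
  weight-power {suc n} (inside ∷ A) = begin
    f * weight A * (q * q ^ ∣ A ∣)     ≡⟨ rearrange f (weight A) q _ ⟩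
    f * (weight A * q ^ ∣ A ∣) * q     ≡⟨ cong (λ x → f * x * q) (weight-power A) ⟩
    f * (f ^ ∣ A ∣ * q ^ n) * q        ≡⟨ rearrange′ f _ _ q ⟩
    f * f ^ ∣ A ∣ * (q * q ^ n)        ∎
    where
    open ≡-Reasoning
    rearrange : ∀ a b c d → a * b * (c * d) ≡ a * (b * d) * c
    rearrange = solve-∀
    rearrange′ : ∀ a b c d → a * (b * c) * d ≡ a * b * (d * c)
    rearrange′ = solve-∀
  weight-power {suc n} (outside ∷ A) = begin
    q * weight A * q ^ ∣ A ∣           ≡⟨ ℕₚ.*-assoc q (weight A) _ ⟩
    q * (weight A * q ^ ∣ A ∣)         ≡⟨ cong (q *_) (weight-power A) ⟩
    q * (f ^ ∣ A ∣ * q ^ n)            ≡⟨ rearrange q (f ^ ∣ A ∣) (q ^ n) ⟩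
    f ^ ∣ A ∣ * (q * q ^ n)            ∎
    where
    open ≡-Reasoning
    rearrange : ∀ a b c → a * (b * c) ≡ b * (a * c)
    rearrange = solve-∀

  -- The union bound. The helper `bound` keeps one unit of slack per requirement, which makes the
  -- result strict.
  total-< : ∀ {n} B Q (L : List (Requirement n)) → 0 < Q → length L ≤ B →
            All (λ (A , _) → B * weight A < Q) L → total L < Q
  total-< B Q []         0<Q _  _   = 0<Q
  total-< B Q L@(_ ∷ L′) _   l≤B all =
    ℕₚ.*-cancelˡ-< B _ _ (ℕₚ.<-≤-trans
      (ℕₚ.m+n≤o⇒m≤o _ (subst (_≤ length L * Q) (ℕₚ.+-suc (B * total L) (length L′)) (bound L all)))
      (ℕₚ.*-monoˡ-≤ Q l≤B))
    where
    rearrange : ∀ B w t l → B * (w + t) + suc l ≡ suc (B * w) + (B * t + l)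
    rearrange = solve-∀
    bound : ∀ L → All (λ (A , _) → B * weight A < Q) L → B * total L + length L ≤ length L * Q
    bound []            []        = ℕₚ.≤-reflexive (trans (ℕₚ.+-identityʳ _) (ℕₚ.*-zeroʳ B))
    bound ((A , i) ∷ L) (lt ∷ lts) =
      subst (_≤ length ((A , i) ∷ L) * Q) (sym (rearrange B (weight A) (total L) (length L)))
        (ℕₚ.+-mono-≤ lt (bound L lts))

-- Inequalities between powers and the colouring of large sets.

length-cartesianProduct : ∀ {A B : Set} (xs : List A) (ys : List B) →
                          length (cartesianProduct xs ys) ≡ length xs * length ys
length-cartesianProduct []       ys = refl
length-cartesianProduct (x ∷ xs) ys =
  trans (length-++ (map (x ,_) ys)) (cong₂ _+_ (length-map (x ,_) ys) (length-cartesianProduct xs ys))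

^-distribʳ-* : ∀ a b k → (a * b) ^ k ≡ a ^ k * b ^ k
^-distribʳ-* a b zero    = refl
^-distribʳ-* a b (suc k) = trans (cong (a * b *_) (^-distribʳ-* a b k)) (rearrange a b (a ^ k) (b ^ k))
  where
  rearrange : ∀ a b c d → a * b * (c * d) ≡ a * c * (b * d)
  rearrange = solve-∀

-- Bernoulli's inequality `1 + k / f ≤ (1 + 1 / f) ^ k`, multiplied by `f ^ suc k`.
bernoulli : ∀ f k → f ^ k * (f + k) ≤ f * suc f ^ k
bernoulli f zero    = ℕₚ.≤-reflexive (lemma f)
  where
  lemma : ∀ f → 1 * (f + 0) ≡ f * 1
  lemma = solve-∀
bernoulli f (suc k) = begin
  f * f ^ k * (f + suc k)              ≤⟨ ℕₚ.m≤m+n _ (k * f ^ k) ⟩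
  f * f ^ k * (f + suc k) + k * f ^ k  ≡⟨ lemma f k (f ^ k) ⟩
  suc f * (f ^ k * (f + k))            ≤⟨ ℕₚ.*-monoʳ-≤ (suc f) (bernoulli f k) ⟩
  suc f * (f * suc f ^ k)              ≡⟨ lemma′ f (suc f ^ k) ⟩
  f * (suc f * suc f ^ k)              ∎
  where
  open ℕₚ.≤-Reasoning
  lemma : ∀ f k x → f * x * (f + suc k) + k * x ≡ suc f * (x * (f + k))
  lemma = solve-∀
  lemma′ : ∀ f x → suc f * (f * x) ≡ f * (suc f * x)
  lemma′ = solve-∀

2*f^f≤[1+f]^f : ∀ f .{{_ : NonZero f}} → 2 * f ^ f ≤ suc f ^ f
2*f^f≤[1+f]^f f = ℕₚ.*-cancelˡ-≤ f (subst (_≤ f * suc f ^ f) (lemma f (f ^ f)) (bernoulli f f))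
  where
  lemma : ∀ f x → x * (f + f) ≡ f * (2 * x)
  lemma = solve-∀

-- Compare `f`-th powers: the hypothesis says `n ^ (2 * f) < 2 ^ s`, and `2 * f ^ f ≤ suc f ^ f`
-- absorbs the factor `2 ^ s`.
¬log-bound⇒power-< : ∀ f n s .{{_ : NonZero f}} → ¬ (s ≤ 2 * f ·log₂ n) → n ^ 2 * f ^ s < suc f ^ s
¬log-bound⇒power-< f n s large = ℕₚ.≰⇒> λ q^s≤ → ℕₚ.<-irrefl refl (begin-strict
  (n ^ 2 * f ^ s) ^ f          ≡⟨ ^-distribʳ-* (n ^ 2) (f ^ s) f ⟩
  (n ^ 2) ^ f * (f ^ s) ^ f    ≡⟨ cong₂ _*_ (ℕₚ.^-*-assoc n 2 f) (exchange f) ⟩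
  n ^ (2 * f) * (f ^ f) ^ s    <⟨ ℕₚ.*-monoˡ-< ((f ^ f) ^ s) (ℕₚ.≰⇒> large) ⟩
  2 ^ s * (f ^ f) ^ s          ≡⟨ ^-distribʳ-* 2 (f ^ f) s ⟨
  (2 * f ^ f) ^ s              ≤⟨ ℕₚ.^-monoˡ-≤ s (2*f^f≤[1+f]^f f) ⟩
  (suc f ^ f) ^ s              ≡⟨ exchange (suc f) ⟨
  (suc f ^ s) ^ f              ≤⟨ ℕₚ.^-monoˡ-≤ f q^s≤ ⟩
  (n ^ 2 * f ^ s) ^ f          ∎)
  where
  open ℕₚ.≤-Reasoning
  instance
    f^f≢0 : NonZero ((f ^ f) ^ s)
    f^f≢0 = ℕₚ.m^n≢0 (f ^ f) s {{ℕₚ.m^n≢0 f f}}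
  exchange : ∀ a → (a ^ s) ^ f ≡ (a ^ f) ^ s
  exchange a = trans (ℕₚ.^-*-assoc a s f) (trans (cong (a ^_) (ℕₚ.*-comm s f)) (sym (ℕₚ.^-*-assoc a f s)))

-- A given colour misses a given large set in less than a fraction `1 / n ^ 2` of all colourings,
-- and `f < n` leaves at most `n * suc f ≤ n ^ 2` pairs of a set and a colour.
hittingColouring : ∀ {n k} (A : Fin k → Subset n) f .{{_ : NonZero f}} → k ≤ n → f < n →
  ∃[ col ] (∀ j → ∣ A j ∣ ≤ 2 * f ·log₂ n ⊎ (∀ (i : Fin (suc f)) → ∃[ v ] (v ∈ A j × col v ≡ i)))
hittingColouring {n} {k} A f k≤n f<n = proj₁ coloured , result
  where
  open Colouring f
  small? : (X : Subset n) → Dec (∣ X ∣ ≤ 2 * f ·log₂ n)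
  small? X = 2 ^ ∣ X ∣ ℕₚ.≤? n ^ (2 * f)

  Xs : List (Subset n)
  Xs = filter (¬? ∘ small?) (map A (allFin k))

  L : List (Requirement n)
  L = cartesianProduct Xs (allFin q)

  length-Xs : length Xs ≤ n
  length-Xs = ℕₚ.≤-trans (length-filter (¬? ∘ small?) (map A (allFin k)))
    (ℕₚ.≤-trans (ℕₚ.≤-reflexive (trans (length-map A (allFin k)) (length-tabulate id))) k≤n)

  length-L : length L ≤ n * q
  length-L = ℕₚ.≤-trans (ℕₚ.≤-reflexive (length-cartesianProduct Xs (allFin q)))
    (ℕₚ.*-mono-≤ length-Xs (ℕₚ.≤-reflexive (length-tabulate id)))

  light : (X : Subset n) → ¬ (∣ X ∣ ≤ 2 * f ·log₂ n) → n * q * weight X < q ^ n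
  light X large = ℕₚ.*-cancelʳ-< (q ^ ∣ X ∣) _ _ (begin-strict
    n * q * weight X * q ^ ∣ X ∣     ≡⟨ ℕₚ.*-assoc (n * q) _ _ ⟩
    n * q * (weight X * q ^ ∣ X ∣)   ≡⟨ cong (n * q *_) (weight-power X) ⟩
    n * q * (f ^ ∣ X ∣ * q ^ n)      ≤⟨ ℕₚ.*-monoˡ-≤ _ (ℕₚ.*-monoʳ-≤ n f<n) ⟩
    n * n * (f ^ ∣ X ∣ * q ^ n)      ≡⟨ rearrange n (f ^ ∣ X ∣) (q ^ n) ⟩
    n ^ 2 * f ^ ∣ X ∣ * q ^ n        <⟨ ℕₚ.*-monoˡ-< (q ^ n) {{ℕₚ.m^n≢0 q n}} (¬log-bound⇒power-< f n ∣ X ∣ large) ⟩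
    q ^ ∣ X ∣ * q ^ n                ≡⟨ ℕₚ.*-comm (q ^ ∣ X ∣) (q ^ n) ⟩
    q ^ n * q ^ ∣ X ∣                ∎)
    where
    open ℕₚ.≤-Reasoning
    rearrange : ∀ n x y → n * n * (x * y) ≡ n * (n * 1) * x * y
    rearrange = solve-∀

  coloured : ∃[ col ] All (Met col) L
  coloured = colouring n L (total-< (n * q) (q ^ n) L (ℕₚ.m^n>0 q n) length-L
    (All.tabulate λ {(X , i)} X∈ →
      light X (proj₂ (∈-filter⁻ (¬? ∘ small?) {xs = map A (allFin k)}
        (proj₁ (∈-cartesianProduct⁻ Xs (allFin q) X∈))))))

  result : ∀ j → ∣ A j ∣ ≤ 2 * f ·log₂ n ⊎ (∀ i → ∃[ v ] (v ∈ A j × proj₁ coloured v ≡ i))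
  result j with small? (A j)
  ... | yes small = inj₁ small
  ... | no large  = inj₂ λ i → All.lookup (proj₂ coloured)
    (∈-cartesianProduct⁺ (∈-filter⁺ (¬? ∘ small?) (∈-map⁺ A (∈-allFin j)) large) (∈-allFin i))

-- Contracting every tree edge from a node of M to its parent.
module Contraction {n : ℕ} (H⁰ : Hierarchy n) {M : Fin (m H⁰) → Set} (M? : U.Decidable M)
                   (root∉M : ¬ M (Hierarchy.root H⁰)) where

  open Hierarchy H⁰ hiding (m; cls; part; below)
  open TreeProperties tree

  infix 4 _⊴_
  _⊴_ : Fin (m H⁰) → Fin (m H⁰) → Set
  _⊴_ = Star (λ x y → M x × x childOf y)

  ⊴⇒≼ : ∀ {x y} → x ⊴ y → x ≼ y
  ⊴⇒≼ = gmap id proj₂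

  private
    climb : ∀ {x} → x ≼ root → ∃[ t ] (x ⊴ t × ¬ M t)
    climb {x} p with M? x
    climb {x} p       | no x∉M = x , ε , x∉M
    climb     ε       | yes r∈M = contradiction r∈M root∉M
    climb     (c ◅ p) | yes x∈M with t , y⊴t , t∉M ← climb p = t , (x∈M , c) ◅ y⊴t , t∉M

  top : Fin (m H⁰) → Fin (m H⁰)
  top x = proj₁ (climb (toRoot x))

  ⊴-top : ∀ x → x ⊴ top x
  ⊴-top x = proj₁ (proj₂ (climb (toRoot x)))

  top∉M : ∀ x → ¬ M (top x)
  top∉M x = proj₂ (proj₂ (climb (toRoot x)))

  ⊴-unique : ∀ {x t t′} → x ⊴ t → ¬ M t → x ⊴ t′ → ¬ M t′ → t ≡ t′
  ⊴-unique ε t∉M ε t′∉M = refl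
  ⊴-unique ε t∉M ((t∈M , _) ◅ _) _ = contradiction t∈M t∉M
  ⊴-unique ((t∈M , _) ◅ _) _ ε t∉M = contradiction t∈M t∉M
  ⊴-unique ((_ , c) ◅ p) t∉M ((_ , d) ◅ q) t′∉M
    with refl ← childOf-unique c d = ⊴-unique p t∉M q t′∉M

  ⊴⇒top≡ : ∀ {x t} → x ⊴ t → ¬ M t → top x ≡ t
  ⊴⇒top≡ {x} p t∉M = ⊴-unique (⊴-top x) (top∉M x) p t∉M

  top-⊴ : ∀ {x y} → x ⊴ y → top x ≡ top y
  top-⊴ {x} {y} p = ⊴⇒top≡ (p ◅◅ ⊴-top y) (top∉M y)

  private
    tops : Subset (m H⁰)
    tops = ⟦ (λ x → ¬? (M? x)) ⟧

    top∈ : ∀ x → top x ∈ tops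
    top∈ x = ∈-⟦⟧⁺ (λ x → ¬? (M? x)) (top∉M x)

  -- Each component contains exactly one node outside `M`, its top; numbering these nodes numbers
  -- the components.
  topOf : Fin ∣ tops ∣ → Fin (m H⁰)
  topOf = nth tops

  topOf∉M : ∀ K → ¬ M (topOf K)
  topOf∉M K = ∈-⟦⟧⁻ (λ x → ¬? (M? x)) (nth-∈ tops K)

  merge : Fin (m H⁰) → Fin ∣ tops ∣
  merge x = rank (top∈ x)

  topOf-merge : ∀ x → topOf (merge x) ≡ top x
  topOf-merge x = nth-rank (top∈ x)

  merge-cong : ∀ {x y} → top x ≡ top y → merge x ≡ merge y
  merge-cong {x} {y} eq = nth-injective tops (trans (topOf-merge x) (trans eq (sym (topOf-merge y))))

  merge⇒top : ∀ {x y} → merge x ≡ merge y → top x ≡ top y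
  merge⇒top {x} {y} eq = trans (sym (topOf-merge x)) (trans (cong topOf eq) (topOf-merge y))

  merge-topOf : ∀ K → merge (topOf K) ≡ K
  merge-topOf K = nth-injective tops (trans (topOf-merge _) (⊴⇒top≡ ε (topOf∉M K)))

  merge≡⇒⊴ : ∀ {x K} → merge x ≡ K → x ⊴ topOf K
  merge≡⇒⊴ {x} refl = subst (x ⊴_) (sym (topOf-merge x)) (⊴-top x)

  ⊴⇒merge≡ : ∀ {x K} → x ⊴ topOf K → merge x ≡ K
  ⊴⇒merge≡ {x} {K} p = trans (merge-cong (top-⊴ p)) (merge-topOf K)

  private
    parent′ : Fin ∣ tops ∣ → Maybe (Fin ∣ tops ∣)
    parent′ K = mapᵐ merge (parent (topOf K))

    _childOf′_ : Fin ∣ tops ∣ → Fin ∣ tops ∣ → Set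
    K childOf′ L = parent′ K ≡ just L

    childOf′⇒ : ∀ {K L} → K childOf′ L → ∃[ p ] (topOf K childOf p × merge p ≡ L)
    childOf′⇒ {K} eq with just p ← parent (topOf K) | refl ← eq = p , refl , refl

    childOf⇒′ : ∀ {x y} → x childOf y → merge x ≡ merge y ⊎ (merge x childOf′ merge y)
    childOf⇒′ {x} {y} c = decide (M? x)
      where
      decide : Dec (M x) → merge x ≡ merge y ⊎ (merge x childOf′ merge y)
      decide (yes x∈M) = inj₁ (merge-cong (top-⊴ ((x∈M , c) ◅ ε)))
      decide (no x∉M)  = inj₂ (cong (mapᵐ merge)
                           (trans (cong parent (trans (topOf-merge x) (⊴⇒top≡ ε x∉M))) c))

    lift : ∀ {x y} → x ≼ y → Star _childOf′_ (merge x) (merge y)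
    lift ε = ε
    lift {x} {y} (c ◅ p) with childOf⇒′ c
    ... | inj₁ eq = subst (λ K → Star _childOf′_ K (merge y)) (sym eq) (lift p)
    ... | inj₂ c′ = c′ ◅ lift p

  tree′ : RootedTree ∣ tops ∣
  tree′ = record
    { root        = merge root
    ; parent      = parent′
    ; parent-root = trans (cong (mapᵐ merge ∘ parent) (trans (topOf-merge root) (⊴⇒top≡ ε root∉M)))
                          (cong (mapᵐ merge) parent-root)
    ; toRoot      = λ K → subst (λ K → Star _childOf′_ K (merge root)) (merge-topOf K) (lift (toRoot (topOf K)))
    }

  private
    module T′ = RootedTree tree′
    module TP′ = TreeProperties tree′

    -- Lifting a path drops its contracted edges and keeps the others. This bounds the new height.
    len-lift : ∀ {x y} (p : x ≼ y) → TP′.len (lift p) ≤ len p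
    len-lift ε = z≤n
    len-lift {x} {y} (c ◅ p) with childOf⇒′ c
    ... | inj₂ c′ = s≤s (len-lift p)
    ... | inj₁ eq = ℕₚ.≤-trans (ℕₚ.≤-reflexive (len-subst (sym eq) (lift p))) (ℕₚ.m≤n⇒m≤1+n (len-lift p))
      where
      len-subst : ∀ {K K′ L} (eq : K ≡ K′) (q : K T′.≼ L) →
                  TP′.len (subst (λ K → K T′.≼ L) eq q) ≡ TP′.len q
      len-subst refl q = refl

    depth-merge : ∀ x → T′.depth (merge x) ≤ depth x
    depth-merge x = ℕₚ.≤-trans (ℕₚ.≤-reflexive (TP′.len-toRoot (T′.toRoot (merge x)) (lift (toRoot x))))
                               (len-lift (toRoot x))

  height′≤ : T′.height ≤ height
  height′≤ = TP′.height≤ λ K →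
    ℕₚ.≤-trans (subst (λ L → T′.depth L ≤ depth (topOf K)) (merge-topOf K) (depth-merge (topOf K)))
               (depth≤height (topOf K))

  H : Hierarchy n
  H = record
    { cls      = merge ∘ cls H⁰
    ; cls-surj = λ K → let v , eq = cls-surj (topOf K) in
                       v , λ { refl → trans (cong merge (eq refl)) (merge-topOf K) }
    ; tree     = tree′
    }

  ≼′⇒≼ : ∀ {K L} → K T′.≼ L → topOf K ≼ topOf L
  ≼′⇒≼ ε = ε
  ≼′⇒≼ (c ◅ p) with q , c′ , refl ← childOf′⇒ c = c′ ◅ (⊴⇒≼ (merge≡⇒⊴ refl) ◅◅ ≼′⇒≼ p)

  ≼⇒≼′ : ∀ {x K} → x ≼ topOf K → merge x T′.≼ K
  ≼⇒≼′ {x} {K} p = subst (merge x T′.≼_) (merge-topOf K) (lift p)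

  below⁺ : ∀ {K v} → v ∈ below H⁰ (topOf K) → v ∈ below H K
  below⁺ {K} v∈ = ∈-⟦⟧⁺ (λ v → merge (cls H⁰ v) T′.≼? K) (≼⇒≼′ (∈-⟦⟧⁻ (λ v → cls H⁰ v ≼? topOf K) v∈))

  below⁻ : ∀ {K v} → v ∈ below H K → v ∈ below H⁰ (topOf K)
  below⁻ {K} v∈ = ∈-⟦⟧⁺ (λ v → cls H⁰ v ≼? topOf K)
    (⊴⇒≼ (merge≡⇒⊴ refl) ◅◅ ≼′⇒≼ (∈-⟦⟧⁻ (λ v → merge (cls H⁰ v) T′.≼? K) v∈))

  part⁺ : ∀ {K v} → cls H⁰ v ⊴ topOf K → v ∈ part H K
  part⁺ {K} p = ∈-⟦⟧⁺ (λ v → merge (cls H⁰ v) Finₚ.≟ K) (⊴⇒merge≡ p)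

  part⁻ : ∀ {K v} → v ∈ part H K → cls H⁰ v ⊴ topOf K
  part⁻ {K} v∈ = merge≡⇒⊴ (∈-⟦⟧⁻ (λ v → merge (cls H⁰ v) Finₚ.≟ K) v∈)

  coarsening : Coarsening H⁰ H
  coarsening = record
    { merge           = merge
    ; merge-surj      = λ K → topOf K , λ { refl → merge-topOf K }
    ; fibre-connected = λ {γ} {δ} eq →
        up refl (⊴-top γ) ◅◅
        subst (λ t → Star (Step (merge γ)) t δ) (sym (merge⇒top {γ} {δ} eq))
          (reverse (λ (p , q , r) → q , p , Sym.symmetric _childOf_ r) (up (sym eq) (⊴-top δ)))
    ; cls-merge       = λ _ → refl
    ; root-merge      = refl
    ; childOf-merge   = mk⇔ to from
    }
    where
    Step : Fin ∣ tops ∣ → Fin (m H⁰) → Fin (m H⁰) → Set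
    Step K x y = merge x ≡ K × merge y ≡ K × SymClosure _childOf_ x y

    up : ∀ {K x t} → merge x ≡ K → x ⊴ t → Star (Step K) x t
    up eq ε = ε
    up eq (s@(_ , c) ◅ p) = let eq′ = trans (sym (merge-cong (top-⊴ (s ◅ ε)))) eq in
      (eq , eq′ , fwd c) ◅ up eq′ p

    to : ∀ {K′ K} → K′ childOf′ K →
         K′ ≢ K × ∃[ γ′ ] ∃[ γ ] (merge γ′ ≡ K′ × merge γ ≡ K × γ′ childOf γ)
    to {K′} c with p , c′ , refl ← childOf′⇒ c =
      (λ eq → ⊏-irrefl (subst (topOf K′ ⊏_) (cong topOf (sym eq)) (p , c′ , ⊴⇒≼ (merge≡⇒⊴ refl)))) ,
      topOf K′ , p , merge-topOf K′ , refl , c′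

    from : ∀ {K′ K} → K′ ≢ K × ∃[ γ′ ] ∃[ γ ] (merge γ′ ≡ K′ × merge γ ≡ K × γ′ childOf γ) →
           K′ childOf′ K
    from (K′≢K , γ′ , γ , refl , refl , c) with childOf⇒′ c
    ... | inj₁ eq = contradiction eq K′≢K
    ... | inj₂ c′ = c′

  isHierarchyOf : ∀ {G : Graph {n} ⊤} → IsHierarchyOf G H⁰ → IsHierarchyOf G H
  isHierarchyOf {G} hier = record
    { height-bound    = ℕₚ.≤-trans (ℕₚ.^-monoʳ-≤ 2 height′≤) height-bound
    ; edge-comparable = comparable
    ; below-connected = λ K u∈ v∈ →
        gmap id (λ (x∈ , y∈ , e) → below⁺ x∈ , below⁺ y∈ , e) (below-connected (topOf K) (below⁻ u∈) (below⁻ v∈))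
    ; child-edge      = λ {K} c → let p , c′ , eq = childOf′⇒ c
                                      u , v , u∈ , v∈ , e = child-edge c′ in
        u , v , part⁺ (subst (_⊴ topOf K) (sym (∈-⟦⟧⁻ (λ v → cls H⁰ v Finₚ.≟ p) u∈)) (merge≡⇒⊴ eq)) , below⁺ v∈ , e
    }
    where
    open IsHierarchyOf hier
    comparable : ∀ {u v} → Adj G u v → (cls H u T′.≺ cls H v) ⊎ (cls H v T′.≼ cls H u)
    comparable e with edge-comparable e
    ... | inj₂ v≼u = inj₂ (lift v≼u)
    ... | inj₁ u≺v with TP′.≼-split (lift (⊏⇒≼ (≺⇒⊏ u≺v)))
    ...   | inj₁ eq  = inj₂ (subst (_ T′.≼_) (sym eq) ε)
    ...   | inj₂ u⊏v = inj₁ (TP′.⊏⇒≺ u⊏v)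

-- Connecting the merged components

module Connectors {n : ℕ} {G : Graph {n} ⊤} {H⁰ : Hierarchy n} (base : IsBaseHierarchy G H⁰) (S : Subset n) where

  open Hierarchy H⁰ hiding (m; cls; part; below)
  open TreeProperties tree
  open IsBaseHierarchy base
  open IsHierarchyOf isHierarchyOf

  Node : Set
  Node = Fin (m H⁰)

  node : Fin n → Node
  node = cls H⁰

  rep : Node → Fin n
  rep γ = proj₁ (cls-surj γ)

  node-rep : ∀ γ → node (rep γ) ≡ γ
  node-rep γ = proj₂ (cls-surj γ) refl

  T∪ : Graph _
  T∪ = unionGraph T⁰

  T∪⇒G : ∀ {u v} → Adj T∪ u v → Adj G u v
  T∪⇒G (γ , e) = proj₂ (T⁰-subgraph γ) e

  -- The edges that force merging when they leave a subtree: those of `T∪` have to stay inside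
  -- components, and the subtree of a component must have no outer neighbour in `S`.
  Free : Fin n → Fin n → Set
  Free u v = Adj T∪ u v ⊎ (Adj G u v × v ∈ S)

  free⇒G : ∀ {u v} → Free u v → Adj G u v
  free⇒G (inj₁ e)       = T∪⇒G e
  free⇒G (inj₂ (e , _)) = e

  R : Node → Set
  R a = ∃[ u ] ∃[ v ] (node u ≼ a × ¬ (node v ≼ a) × Free u v)

  R? : U.Decidable R
  R? a = Finₚ.any? λ u → Finₚ.any? λ v →
    (node u ≼? a) ×-dec ¬? (node v ≼? a) ×-dec (adj? T∪ u v ⊎-dec (adj? G u v ×-dec (v ∈? S)))

  root∉R : ¬ R root
  root∉R (_ , v , _ , v⋠ , _) = v⋠ (toRoot (node v))

  adj-comparable : ∀ {u v} → Adj G u v → node u ⊏ node v ⊎ node v ≼ node u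
  adj-comparable e with edge-comparable e
  ... | inj₁ u≺v = inj₁ (≺⇒⊏ u≺v)
  ... | inj₂ v≼u = inj₂ v≼u

  adj-leaving : ∀ {u v a} → Adj G u v → node u ≼ a → ¬ (node v ≼ a) → a ⊏ node v
  adj-leaving e u≼a v⋠a with adj-comparable e
  ... | inj₂ v≼u = contradiction (v≼u ◅◅ u≼a) v⋠a
  ... | inj₁ u⊏v with ancestors-comparable (⊏⇒≼ u⊏v) u≼a
  ...   | inj₁ v≼a = contradiction v≼a v⋠a
  ...   | inj₂ a⊏v = a⊏v

  -- The connecting edge E a joins tgt E a, a vertex below a, to par E a.
  Assignment : Set
  Assignment = Node → Fin n × Fin n

  tgt par : Assignment → Node → Fin n
  tgt E a = proj₁ (E a)
  par E a = proj₂ (E a)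

  -- Merging a forces merging d, so that tgt E a lies in the component of a.
  _⊢_▷_ : Assignment → Node → Node → Set
  E ⊢ a ▷ d = d ⊏ a × node (tgt E a) ≼ d

  -- The closure of `R` under forcing, presented by chains so that reachability decides membership.
  record M (E : Assignment) (d : Node) : Set where
    constructor merged
    field
      {source} : Node
      source∈R : R source
      chain    : Star (E ⊢_▷_) source d

  M? : ∀ E → U.Decidable (M E)
  M? E d = map′ (λ (_ , r , p) → merged r p) (λ (merged r p) → _ , r , p)
    (Finₚ.any? λ a → R? a ×-dec star? (λ a d → (d ⊏? a) ×-dec (node (tgt E a) ≼? d)) a d)

  R⊆M : ∀ {E d} → R d → M E d
  R⊆M r = merged r ε

  ▷-M : ∀ {E a d} → M E a → E ⊢ a ▷ d → M E d
  ▷-M (merged r p) s = merged r (p ◅◅ (s ◅ ε))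

  M-cases : ∀ {E d} → M E d → R d ⊎ ∃[ a ] (M E a × E ⊢ a ▷ d)
  M-cases (merged r ε)        = inj₁ r
  M-cases {E} (merged r (s ◅ p)) = inj₂ (go (R⊆M r) s p)
    where
    go : ∀ {a b d} → M E a → E ⊢ a ▷ b → Star (E ⊢_▷_) b d → ∃[ c ] (M E c × E ⊢ c ▷ d)
    go a∈M s ε       = _ , a∈M , s
    go a∈M s (t ◅ p) = go (▷-M a∈M s) t p

  root∉M : ∀ {E} → ¬ M E root
  root∉M r∈M with M-cases r∈M
  ... | inj₁ r                  = root∉R r
  ... | inj₂ (_ , _ , r⊏ , _) = root-⋤ r⊏

  -- Merged tree paths and valid assignments.

  _⊢_⊴_ : Assignment → Node → Node → Set
  E ⊢ x ⊴ y = Star (λ x y → M E x × x childOf y) x y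

  ⊴⇒≼ : ∀ {E x y} → E ⊢ x ⊴ y → x ≼ y
  ⊴⇒≼ = gmap id proj₂

  ⊴-intro : ∀ {E x y} → (∀ {d} → x ≼ d → d ⊏ y → M E d) → x ≼ y → E ⊢ x ⊴ y
  ⊴-intro f ε       = ε
  ⊴-intro f (c ◅ p) = (f ε (_ , c , p) , c) ◅ ⊴-intro (λ q → f (c ◅ q)) p

  ⊴-elim : ∀ {E x y d} → E ⊢ x ⊴ y → x ≼ d → d ⊏ y → M E d
  ⊴-elim ε q d⊏y = contradiction q (⊏⇒⋠ d⊏y)
  ⊴-elim ((x∈M , _) ◅ _) ε _ = x∈M
  ⊴-elim ((_ , c) ◅ p) (c′ ◅ q) d⊏y with refl ← childOf-unique c c′ = ⊴-elim p q d⊏y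

  ⊴-suffix : ∀ {E x y z} → E ⊢ x ⊴ z → x ≼ y → y ≼ z → E ⊢ y ⊴ z
  ⊴-suffix p q r = ⊴-intro (λ y≼d → ⊴-elim p (q ◅◅ y≼d)) r

  ⊴-prefix : ∀ {E x y z} → E ⊢ x ⊴ z → x ≼ y → y ≼ z → E ⊢ x ⊴ y
  ⊴-prefix p q r = ⊴-intro (λ x≼d d⊏y → ⊴-elim p x≼d (⊏-≼-trans d⊏y r)) q

  -- The edge leaves the subtree of every node from `node u` up to, but excluding, `a`, so all of
  -- them are in `R`.
  free-⊴ : ∀ {E u v a} → Free u v → node u ≼ a → a ≼ node v → E ⊢ node u ⊴ a
  free-⊴ {u = u} {v} e u≼a a≼v =
    ⊴-intro (λ u≼d d⊏a → R⊆M (u , v , u≼d , ⊏⇒⋠ (⊏-≼-trans d⊏a a≼v) , e)) u≼a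

  -- The last condition prevents a from being charged with two edges at p.
  Choice : Assignment → Node → Fin n → Fin n → Set
  Choice E a t p =
    (p ∈ S × ¬ (node p ≼ a) × Adj G t p) ⊎
    (E ⊢ node p ⊴ a × (∀ {d} → d ⊏ a → ¬ R d → node t ≼ d → par E d ≢ p))

  record Valid (E : Assignment) : Set where
    field
      tgt-below : ∀ a → node (tgt E a) ≼ a
      par-∉R    : ∀ {a p} → ¬ R a → a childOf p → node (par E a) ≡ p × Adj G (tgt E a) (par E a)
      par-∈R    : ∀ {a} → R a → Choice E a (tgt E a) (par E a)

  Ends : Assignment → Node → Fin n → Fin n → Set
  Ends E γ u v = (u ≡ tgt E γ × v ≡ par E γ) ⊎ (u ≡ par E γ × v ≡ tgt E γ)

  -- `Q` restricts the nodes whose edges may be used, so that claims about a subtree refer to edges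
  -- assigned inside it. `Adj G u v` discards assigned pairs that are not edges.
  Extra : Assignment → (Node → Set) → Fin n → Fin n → Set
  Extra E Q u v = ∃[ γ ] (M E γ × Q γ × Ends E γ u v × Adj G u v)

  Link : Assignment → (Node → Set) → Fin n → Fin n → Set
  Link E Q u v = Adj T∪ u v ⊎ Extra E Q u v

  link⇒G : ∀ {E Q u v} → Link E Q u v → Adj G u v
  link⇒G (inj₁ e)                   = T∪⇒G e
  link⇒G (inj₂ (_ , _ , _ , _ , e)) = e

  Conn : Assignment → (Node → Set) → Fin n → Fin n → Set
  Conn E Q = Star (Link E Q)

  ends-sym : ∀ {E γ u v} → Ends E γ u v → Ends E γ v u
  ends-sym (inj₁ (p , q)) = inj₂ (q , p)
  ends-sym (inj₂ (p , q)) = inj₁ (q , p)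

  link-sym : ∀ {E Q u v} → Link E Q u v → Link E Q v u
  link-sym {E} (inj₁ e)                  = inj₁ (adj-sym T∪ e)
  link-sym {E} (inj₂ (γ , γ∈ , q , s , e)) = inj₂ (γ , γ∈ , q , ends-sym {E} {γ} s , adj-sym G e)

  conn-sym : ∀ {E Q u v} → Conn E Q u v → Conn E Q v u
  conn-sym = reverse link-sym

  conn-weaken : ∀ {E} {P Q : Node → Set} → (∀ {γ} → P γ → Q γ) → ∀ {u v} → Conn E P u v → Conn E Q u v
  conn-weaken f = gmap id λ { (inj₁ e) → inj₁ e ; (inj₂ (γ , γ∈ , p , s)) → inj₂ (γ , γ∈ , f p , s) }

  -- The Steiner tree of the node joins its vertices, and its edges belong to `T∪`.
  conn-node : ∀ {E Q u v} → node u ≡ node v → Conn E Q u v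
  conn-node {u = u} {v} eq = gmap id (λ e → inj₁ (node v , e))
    (proj₁ (T⁰-tree (node v)) (T⁰-spans _ (∈part eq)) (T⁰-spans _ (∈part refl)))
    where
    ∈part : ∀ {w γ} → node w ≡ γ → w ∈ part H⁰ γ
    ∈part {γ = γ} = ∈-⟦⟧⁺ (λ w → node w Finₚ.≟ γ)

  -- The invariant of the construction: the class of a is attached to something
  -- above a by connecting edges assigned to descendants of a.
  Attached : Assignment → Node → Set
  Attached E a = ∃[ v ] (a ⊏ node v × Conn E (_≼ a) (rep a) v)

  -- An attachment leads from the class of `x` to some `v₁` above `x`. Its node and `a` are both
  -- ancestors of `x`: either `v₁` is still in the subtree of `a` and the climb continues at smaller
  -- depth, or it has overshot `a`.
  climb : ∀ {E} a → (∀ {γ} → M E γ → γ ⊏ a → Attached E γ) → ∀ v → E ⊢ node v ⊴ a →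
          Conn E (_⊏ a) v (rep a) ⊎ ∃[ v′ ] (a ⊏ node v′ × Conn E (_⊏ a) v v′)
  climb {E} a lower v p = go v refl p (<-wellFounded _)
    where
    go : ∀ v {x} → node v ≡ x → E ⊢ x ⊴ a → Acc _<_ (depth x) →
         Conn E (_⊏ a) v (rep a) ⊎ ∃[ v′ ] (a ⊏ node v′ × Conn E (_⊏ a) v v′)
    go v eq ε _ = inj₁ (conn-node (trans eq (sym (node-rep a))))
    go v {x} eq (s@(x∈M , c) ◅ p) (acc rs) = continue (lower x∈M x⊏a)
      where
      x⊏a : x ⊏ a
      x⊏a = _ , c , ⊴⇒≼ p

      continue : Attached E x → Conn E (_⊏ a) v (rep a) ⊎ ∃[ v′ ] (a ⊏ node v′ × Conn E (_⊏ a) v v′)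
      continue (v₁ , x⊏v₁ , q) = [ inside-a , outside-a ]′ (ancestors-comparable (⊏⇒≼ x⊏v₁) (⊏⇒≼ x⊏a))
        where
        v~v₁ : Conn E (_⊏ a) v v₁
        v~v₁ = conn-node (trans eq (sym (node-rep x))) ◅◅ conn-weaken (λ γ≼x → ≼-⊏-trans γ≼x x⊏a) q

        inside-a : node v₁ ≼ a → _
        inside-a v₁≼a with go v₁ refl (⊴-suffix (s ◅ p) (⊏⇒≼ x⊏v₁) v₁≼a) (rs (depth-⊏ x⊏v₁))
        ... | inj₁ r             = inj₁ (v~v₁ ◅◅ r)
        ... | inj₂ (v′ , a⊏ , r) = inj₂ (v′ , a⊏ , v~v₁ ◅◅ r)

        outside-a : a ⊏ node v₁ → _
        outside-a a⊏v₁ = inj₂ (v₁ , a⊏v₁ , v~v₁)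

  module _ {E : Assignment} (valid : Valid E) where
    open Valid valid

    tgt-⊴ : ∀ {a} → M E a → E ⊢ node (tgt E a) ⊴ a
    tgt-⊴ {a} a∈M = ⊴-intro (λ q d⊏a → ▷-M a∈M (d⊏a , q)) (tgt-below a)

    -- By validity both ends lie below `d`, except possibly a parent end in `S`; outside the subtree
    -- of `d` it would put `d` into `R`.
    extra-stays : ∀ {d u v} → ¬ R d → Extra E (_⊏ d) u v → node v ≼ d
    extra-stays {d} d∉R (γ , γ∈M , γ⊏d@(p , c , p≼d) , s , _) = ends s
      where
      tgt≼ : node (tgt E γ) ≼ d
      tgt≼ = tgt-below γ ◅◅ ⊏⇒≼ γ⊏d

      par≼ : node (par E γ) ≼ d
      par≼ with R? γ
      ... | no γ∉R rewrite proj₁ (par-∉R γ∉R c) = p≼d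
      ... | yes γ∈R with par-∈R γ∈R
      ...   | inj₂ (par⊴γ , _) = ⊴⇒≼ par⊴γ ◅◅ ⊏⇒≼ γ⊏d
      ...   | inj₁ (∈S , _ , e) with node (par E γ) ≼? d
      ...     | yes par≼d = par≼d
      ...     | no par⋠d  = contradiction (_ , _ , tgt≼ , par⋠d , inj₂ (e , ∈S)) d∉R

      ends : ∀ {u v} → Ends E γ u v → node v ≼ d
      ends (inj₁ (_ , refl)) = par≼
      ends (inj₂ (_ , refl)) = tgt≼

    conn-stays : ∀ {d u v} → ¬ R d → node u ≼ d → Conn E (_⊏ d) u v → node v ≼ d
    conn-stays d∉R u≼d ε = u≼d
    conn-stays d∉R u≼d (inj₂ x ◅ p) = conn-stays d∉R (extra-stays d∉R x) p
    conn-stays {d} d∉R u≼d (_◅_ {j = w} (inj₁ e) p) with node w ≼? d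
    ... | yes w≼d = conn-stays d∉R w≼d p
    ... | no w⋠d  = contradiction (_ , _ , u≼d , w⋠d , inj₁ e) d∉R

    -- For d ∉ R no admissible edge leaves the subtree of d, so climbing from a
    -- merged descendant cannot overshoot d.
    private
      Good : Node → Set
      Good d = (∀ {γ} → R γ → γ ⊏ d → Attached E γ) →
        (¬ R d → ∀ {v} → E ⊢ node v ⊴ d → Conn E (_⊏ d) v (rep d)) ×
        (¬ R d → M E d → ∀ {v} → E ⊢ node v ⊴ d → Conn E (_≼ d) v (par E d)) ×
        (M E d → (R d → Attached E d) → Attached E d)

      good : ∀ d → Good d
      good = ⊏-rec Good step
        where
        step : ∀ d → (∀ {γ} → γ ⊏ d → Good γ) → Good d
        step d ih hyp = conn , toPar , attached
          where
          lower : ∀ {γ} → M E γ → γ ⊏ d → Attached E γ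
          lower γ∈M γ⊏d = proj₂ (proj₂ (ih γ⊏d (λ r δ⊏γ → hyp r (⊏-≼-trans δ⊏γ (⊏⇒≼ γ⊏d))))) γ∈M
                            (λ r → hyp r γ⊏d)

          conn : ¬ R d → ∀ {v} → E ⊢ node v ⊴ d → Conn E (_⊏ d) v (rep d)
          conn d∉R {v} p with climb d lower v p
          ... | inj₁ q = q
          ... | inj₂ (v′ , d⊏v′ , q) = contradiction (conn-stays d∉R (⊴⇒≼ p) q) (⊏⇒⋠ d⊏v′)

          parent-of : ¬ R d → M E d → ∃[ p ] (d childOf p)
          parent-of d∉R d∈M with M-cases d∈M
          ... | inj₁ d∈R = contradiction d∈R d∉R
          ... | inj₂ (_ , _ , (p , c , _) , _) = p , c

          toPar : ¬ R d → M E d → ∀ {v} → E ⊢ node v ⊴ d → Conn E (_≼ d) v (par E d)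
          -- Both `v` and the target of `d` reach `rep d`; from the target the edge of `d` leads to
          -- its parent end.
          toPar d∉R d∈M p =
            conn-weaken ⊏⇒≼ (conn d∉R p ◅◅ conn-sym (conn d∉R (tgt-⊴ d∈M))) ◅◅
            (inj₂ (d , d∈M , ε , inj₁ (refl , refl) , proj₂ (par-∉R d∉R (proj₂ (parent-of d∉R d∈M)))) ◅ ε)

          attached : M E d → (R d → Attached E d) → Attached E d
          attached d∈M ifR with R? d
          ... | yes d∈R = ifR d∈R
          ... | no d∉R with q , c ← parent-of d∉R d∈M =
            par E d , (q , c , subst (q ≼_) (sym (proj₁ (par-∉R d∉R c))) ε) ,
            toPar d∉R d∈M (subst (λ x → E ⊢ x ⊴ d) (sym (node-rep d)) ε)

    module _ {d : Node} (hyp : ∀ {γ} → R γ → γ ⊏ d → Attached E γ) where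

      conn-rep : ¬ R d → ∀ {v} → E ⊢ node v ⊴ d → Conn E (_⊏ d) v (rep d)
      conn-rep = proj₁ (good d hyp)

      conn-par : ¬ R d → M E d → ∀ {v} → E ⊢ node v ⊴ d → Conn E (_≼ d) v (par E d)
      conn-par = proj₁ (proj₂ (good d hyp))

      attached-below : ∀ {γ} → M E γ → γ ⊏ d → Attached E γ
      attached-below {γ} γ∈M γ⊏d = proj₂ (proj₂ (good γ λ r δ⊏γ → hyp r (⊏-≼-trans δ⊏γ (⊏⇒≼ γ⊏d)))) γ∈M
                                     (λ r → hyp r γ⊏d)

  -- Replacing placeholders in an assignment.

  -- A placeholder without effect: the pair is a loop, hence no edge, and its target lies in `a`
  -- itself, so it forces nothing.
  default : Assignment
  default a = rep a , rep a

  infix 4 _⊑ᴱ_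
  -- Only placeholders are replaced, so merged nodes, links and attachments survive.
  _⊑ᴱ_ : Assignment → Assignment → Set
  E ⊑ᴱ E′ = ∀ x → E x ≡ E′ x ⊎ E x ≡ default x

  module _ {E E′ : Assignment} (E⊑E′ : E ⊑ᴱ E′) where

    ▷-mono : ∀ {a d} → E ⊢ a ▷ d → E′ ⊢ a ▷ d
    ▷-mono {a} {d} (d⊏a , q) with E⊑E′ a
    ... | inj₁ eq = d⊏a , subst (λ e → node (proj₁ e) ≼ d) eq q
    ... | inj₂ eq = contradiction
      (subst (_≼ d) (node-rep a) (subst (λ e → node (proj₁ e) ≼ d) eq q)) (⊏⇒⋠ d⊏a)

    M-mono : ∀ {d} → M E d → M E′ d
    M-mono (merged r p) = merged r (gmap id ▷-mono p)

    ⊴-mono : ∀ {x y} → E ⊢ x ⊴ y → E′ ⊢ x ⊴ y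
    ⊴-mono = gmap id λ (x∈M , c) → M-mono x∈M , c

    link-mono : ∀ {Q u v} → Link E Q u v → Link E′ Q u v
    link-mono (inj₁ e) = inj₁ e
    link-mono {u = u} {v} (inj₂ (γ , γ∈M , q , s , e)) with E⊑E′ γ
    ... | inj₁ eq = inj₂ (γ , M-mono γ∈M , q ,
                    subst (λ (t , p) → (u ≡ t × v ≡ p) ⊎ (u ≡ p × v ≡ t)) eq s , e)
    ... | inj₂ eq = contradiction e (adj-irrefl G
                    (loop (subst (λ (t , p) → (u ≡ t × v ≡ p) ⊎ (u ≡ p × v ≡ t)) eq s)))
      where
      loop : ∀ {w : Fin n} → (u ≡ w × v ≡ w) ⊎ (u ≡ w × v ≡ w) → u ≡ v
      loop (inj₁ (p , q)) = trans p (sym q)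
      loop (inj₂ (p , q)) = trans p (sym q)

    conn-mono : ∀ {Q u v} → Conn E Q u v → Conn E′ Q u v
    conn-mono = gmap id link-mono

    attached-mono : ∀ {a} → Attached E a → Attached E′ a
    attached-mono (v , a⊏v , q) = v , a⊏v , conn-mono q

  update : Assignment → Node → Fin n × Fin n → Assignment
  update E a e x with x Finₚ.≟ a
  ... | yes _ = e
  ... | no _  = E x

  update-at : ∀ E a e → update E a e a ≡ e
  update-at E a e with a Finₚ.≟ a
  ... | yes _  = refl
  ... | no a≢a = contradiction refl a≢a

  update-off : ∀ E a e {x} → x ≢ a → E x ≡ update E a e x
  update-off E a e {x} x≢a with x Finₚ.≟ a
  ... | yes x≡a = contradiction x≡a x≢a
  ... | no _    = refl

  off⇒⊑ : ∀ {E E′ a} → E a ≡ default a → (∀ {x} → x ≢ a → E x ≡ E′ x) → E ⊑ᴱ E′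
  off⇒⊑ {a = a} def off x with x Finₚ.≟ a
  ... | yes refl = inj₂ def
  ... | no x≢a   = inj₁ (off x≢a)

  choice-mono : ∀ {E E′ a t p} → E ⊑ᴱ E′ → (∀ {d} → ¬ R d → E d ≡ E′ d) →
                Choice E a t p → Choice E′ a t p
  choice-mono E⊑E′ same (inj₁ c) = inj₁ c
  choice-mono E⊑E′ same (inj₂ (c , f)) = inj₂ (⊴-mono E⊑E′ c ,
    λ d⊏a d∉R t≼d eq → f d⊏a d∉R t≼d (trans (cong proj₂ (same d∉R)) eq))

  update-valid : ∀ {E a t p} → Valid E → R a → E a ≡ default a → node t ≼ a → Choice E a t p →
                 Valid (update E a (t , p))
  update-valid {E} {a} {t} {p} valid a∈R def t≼a choice = record
    { tgt-below = below-ok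
    ; par-∉R    = λ {x} x∉R c → subst (λ (t , p) → node p ≡ _ × Adj G t p) (same x∉R) (par-∉R x∉R c)
    ; par-∈R    = λ {x} x∈R → choice-mono E⊑E′ same (choice-ok x x∈R)
    }
    where
    open Valid valid
    E′ : Assignment
    E′ = update E a (t , p)

    same : ∀ {d} → ¬ R d → E d ≡ E′ d
    same d∉R = update-off E a (t , p) λ { refl → d∉R a∈R }

    E⊑E′ : E ⊑ᴱ E′
    E⊑E′ = off⇒⊑ def (update-off E a (t , p))

    below-ok : ∀ x → node (tgt E′ x) ≼ x
    below-ok x with x Finₚ.≟ a
    ... | yes refl = t≼a
    ... | no _     = tgt-below x

    choice-ok : ∀ x → R x → Choice E x (tgt E′ x) (par E′ x)
    choice-ok x x∈R with x Finₚ.≟ a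
    ... | yes refl = choice
    ... | no _     = par-∈R x∈R

  -- Choosing the connecting edge of a node of `R`.

  Step : Assignment → Node → Set
  Step E a = ∃[ E′ ] (Valid E′ × (∀ {x} → x ≢ a → E x ≡ E′ x) × Attached E′ a)

  module _ {E : Assignment} (valid : Valid E) {a : Node} (a∈R : R a) (def : E a ≡ default a)
           (hyp : ∀ {γ} → R γ → γ ⊏ a → Attached E γ) where
    open Valid valid

    private
      Low Up : Fin n → Set
      Low x = Conn E (_⊏ a) x (rep a)
      Up x = ∃[ v ] (a ⊏ node v × Conn E (_⊏ a) x v)

      status : ∀ {x} → E ⊢ node x ⊴ a → Low x ⊎ Up x
      status {x} = climb a (attached-below valid hyp) x

      Split : Fin n → Fin n → Set
      Split x y = (Low x × Up y) ⊎ (Up x × Low y)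

      -- Reduces the step to finding or creating a path from a low vertex to an up vertex.
      bridge : ∀ {E′ x y} → E ⊑ᴱ E′ → Split x y → Conn E′ (_≼ a) x y → Attached E′ a
      bridge E⊑ (inj₁ (low , (v , a⊏v , up))) p =
        v , a⊏v , conn-sym (conn-weaken ⊏⇒≼ (conn-mono E⊑ low)) ◅◅ p ◅◅ conn-weaken ⊏⇒≼ (conn-mono E⊑ up)
      bridge E⊑ (inj₂ ((v , a⊏v , up) , low)) p =
        v , a⊏v , conn-sym (conn-weaken ⊏⇒≼ (conn-mono E⊑ low)) ◅◅ conn-sym p ◅◅ conn-weaken ⊏⇒≼ (conn-mono E⊑ up)

      unchanged : ∀ {x y} → Split x y → Conn E (_⊏ a) x y → Step E a
      unchanged s p = E , valid , (λ _ → refl) , bridge (λ _ → inj₁ refl) s (conn-weaken ⊏⇒≼ p)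

      changed : ∀ {t p} → node t ≼ a → Choice E a t p →
                (∀ {E′} → E ⊑ᴱ E′ → Valid E′ → E′ a ≡ (t , p) → (∀ {d} → ¬ R d → E d ≡ E′ d) → Attached E′ a) →
                Step E a
      changed {t} {p} t≼a choice f =
        update E a (t , p) , v′ , update-off E a (t , p) ,
        f (off⇒⊑ def (update-off E a (t , p))) v′ (update-at E a (t , p))
          (λ d∉R → update-off E a (t , p) λ { refl → d∉R a∈R })
        where
        v′ : Valid (update E a (t , p))
        v′ = update-valid valid a∈R def t≼a choice

      own-link : ∀ {E′ t p} → E′ a ≡ (t , p) → Adj G t p → Link E′ (_≼ a) t p
      own-link eq e = inj₂ (a , R⊆M a∈R , ε , inj₁ (sym (cong proj₁ eq) , sym (cong proj₂ eq)) , e)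

      -- The subtree of d hangs off the merged component of a.
      Blob : Node → Set
      Blob d = d ⊏ a × ¬ M E d × ∃[ p ] (d childOf p × E ⊢ p ⊴ a)

      -- If one blob were strictly below another, the upper one would lie on the merged path from
      -- the parent of the lower one to `a`, but blobs are unmerged.
      blob-unique : ∀ {x d d′} → x ≼ d → x ≼ d′ → Blob d → Blob d′ → d ≡ d′
      blob-unique x≼d x≼d′ b b′ = [ go b b′ , (λ d′⊏d → sym (go b′ b (⊏⇒≼ d′⊏d))) ]′ (ancestors-comparable x≼d x≼d′)
        where
        go : ∀ {d d′} → Blob d → Blob d′ → d ≼ d′ → d ≡ d′
        go _ _ ε = refl
        go (_ , _ , p , c , p⊴a) (d′⊏a , d′∉M , _) (c′ ◅ q)
          with refl ← childOf-unique c c′ = contradiction (⊴-elim p⊴a q d′⊏a) d′∉M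

      -- Where z gets attached once its path up to a is merged.
      Anchor : Fin n → Fin n → Set
      Anchor z w = (E ⊢ node z ⊴ a × w ≡ z) ⊎ ∃[ d ] (Blob d × node z ≼ d × w ≡ par E d)

      anchor : ∀ z → node z ≼ a → ∃[ w ] Anchor z w
      anchor z z≼a = [ (λ p → z , inj₁ (p , refl)) , (λ (d , b , q) → par E d , inj₂ (d , b , q , refl)) ]′ (go z≼a)
        where
        go : ∀ {x} → x ≼ a → E ⊢ x ⊴ a ⊎ ∃[ d ] (Blob d × x ≼ d)
        go ε = inj₁ ε
        go {x} (c ◅ p) with go p
        ... | inj₂ (d , b , q) = inj₂ (d , b , c ◅ q)
        ... | inj₁ p⊴a with M? E x
        ...   | yes x∈M = inj₁ ((x∈M , c) ◅ p⊴a)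
        ...   | no x∉M  = inj₂ (x , ((_ , c , p) , x∉M , _ , c , p⊴a) , ε)

      anchor-⊴ : ∀ {z w} → Anchor z w → E ⊢ node w ⊴ a
      anchor-⊴ (inj₁ (p , refl)) = p
      anchor-⊴ (inj₂ (d , (_ , d∉M , p , c , p⊴a) , _ , refl)) =
        subst (λ x → E ⊢ x ⊴ a) (sym (proj₁ (par-∉R (λ r → d∉M (R⊆M r)) c))) p⊴a

      blob-⋬ : ∀ {x d} → Blob d → x ≼ d → ¬ (E ⊢ x ⊴ a)
      blob-⋬ (d⊏a , d∉M , _) x≼d p = d∉M (⊴-elim p x≼d d⊏a)

      hyp-below : ∀ {d} → d ⊏ a → ∀ {γ} → R γ → γ ⊏ d → Attached E γ
      hyp-below d⊏a r γ⊏d = hyp r (⊏-≼-trans γ⊏d (⊏⇒≼ d⊏a))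

      -- If merging up from z′ would use an edge at z anyway, then z and the
      -- anchor of z′ are connected already.
      clash : ∀ {z z′ w d} → E ⊢ node z ⊴ a → Anchor z′ w → d ⊏ a → ¬ R d → node z′ ≼ d → par E d ≡ z →
              Conn E (_⊏ a) z w
      clash {z} {z′} {w} {d} z⊴a anc d⊏a@(p , c , _) d∉R z′≼d refl = decide (M? E d) anc
        where
        p⊴a : E ⊢ p ⊴ a
        p⊴a = subst (λ x → E ⊢ x ⊴ a) (proj₁ (par-∉R d∉R c)) z⊴a

        w⊴d : M E d → Anchor z′ w → E ⊢ node w ⊴ d
        w⊴d d∈M (inj₁ (z′⊴a , refl)) = ⊴-prefix z′⊴a z′≼d (⊏⇒≼ d⊏a)
        w⊴d d∈M anc@(inj₂ (d₀ , b@(d₀⊏a , d₀∉M , p₀ , c₀ , p₀⊴a) , z′≼d₀ , refl))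
          with ancestors-comparable z′≼d z′≼d₀
        ... | inj₁ d≼d₀ = contradiction ((d∈M , c) ◅ p⊴a) (blob-⋬ b d≼d₀)
        ... | inj₂ (p₁ , c₁ , p₁≼d) with refl ← childOf-unique c₀ c₁ =
          subst (λ x → E ⊢ x ⊴ d) (sym (proj₁ (par-∉R (λ r → d₀∉M (R⊆M r)) c₀))) (⊴-prefix p₀⊴a p₁≼d (⊏⇒≼ d⊏a))

        decide : Dec (M E d) → Anchor z′ w → Conn E (_⊏ a) z w
        decide (yes d∈M) anc = conn-weaken (λ γ≼d → ≼-⊏-trans γ≼d d⊏a)
          (conn-sym (conn-par valid (hyp-below d⊏a) d∉R d∈M (w⊴d d∈M anc)))
        decide (no d∉M) (inj₁ (z′⊴a , _)) = contradiction z′⊴a (blob-⋬ (d⊏a , d∉M , p , c , p⊴a) z′≼d)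
        decide (no d∉M) (inj₂ (d₀ , b , z′≼d₀ , refl))
          with refl ← blob-unique z′≼d₀ z′≼d b (d⊏a , d∉M , p , c , p⊴a) = ε

      -- Giving `a` the edge from `z′` to `z` merges the path above `z′`, which connects `z′` to its
      -- anchor `w`. If this would charge `a` twice at `z`, then `z` and `w` are connected already
      -- by `clash`.
      join : ∀ {z z′ w} → E ⊢ node z ⊴ a → node z′ ≼ a → Anchor z′ w → Adj G z z′ → Split z w → Step E a
      join {z} {z′} {w} z⊴a z′≼a anc e split
        with Finₚ.any? (λ d → (d ⊏? a) ×-dec ¬? (R? d) ×-dec (node z′ ≼? d) ×-dec (par E d Finₚ.≟ z))
      ... | yes (d , d⊏a , d∉R , z′≼d , eq) = unchanged split (clash z⊴a anc d⊏a d∉R z′≼d eq)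
      ... | no none = changed z′≼a (inj₂ (z⊴a , λ d⊏a d∉R z′≼d eq → none (_ , d⊏a , d∉R , z′≼d , eq))) finish
        where
        finish : ∀ {E′} → E ⊑ᴱ E′ → Valid E′ → E′ a ≡ (z′ , z) → (∀ {d} → ¬ R d → E d ≡ E′ d) → Attached E′ a
        finish {E′} E⊑E′ valid′ eq same =
          bridge E⊑E′ split (link-sym (own-link eq (adj-sym G e)) ◅ opened anc)
          where
          opens : ∀ {d} → d ⊏ a → node z′ ≼ d → M E′ d
          opens d⊏a z′≼d = ▷-M (R⊆M a∈R) (d⊏a , subst (λ t → node t ≼ _) (sym (cong proj₁ eq)) z′≼d)

          opened : Anchor z′ w → Conn E′ (_≼ a) z′ w
          opened (inj₁ (_ , refl)) = ε
          opened (inj₂ (d , (d⊏a , d∉M , _) , z′≼d , refl)) =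
            subst (Conn E′ (_≼ a) z′) (sym (cong proj₂ (same d∉R)))
              (conn-weaken (_◅◅ ⊏⇒≼ d⊏a)
                (conn-par valid′ (λ r γ⊏d → attached-mono E⊑E′ (hyp-below d⊏a r γ⊏d)) d∉R (opens d⊏a z′≼d)
                  (⊴-intro (λ z′≼x x⊏d → opens (⊏-≼-trans x⊏d (⊏⇒≼ d⊏a)) z′≼x) z′≼d)))
            where
            d∉R : ¬ R d
            d∉R r = d∉M (R⊆M r)

      -- An end that is merged with `a` becomes the parent end of the new edge. If both ends lie in
      -- blobs, adjacency makes their nodes comparable, so the blobs coincide and their anchor is
      -- both low and up.
      crossing : ∀ {x x′ w w′} → node x ≼ a → node x′ ≼ a → Adj G x x′ →
                 Anchor x w → Low w → Anchor x′ w′ → Up w′ → Step E a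
      crossing _ x′≼a e (inj₁ (x⊴a , refl)) low anc up = join x⊴a x′≼a anc e (inj₁ (low , up))
      crossing x≼a _ e anc@(inj₂ _) low (inj₁ (x′⊴a , refl)) up =
        join x′⊴a x≼a anc (adj-sym G e) (inj₂ (up , low))
      crossing _ _ e (inj₂ (d , b , x≼d , refl)) low (inj₂ (d′ , b′ , x′≼d′ , refl)) up =
        unchanged (inj₁ (low , up))
          (subst (λ d′ → Conn E (_⊏ a) (par E d) (par E d′)) (same-blob (adj-comparable e)) ε)
        where
        same-blob : _ → d ≡ d′
        same-blob (inj₁ x⊏x′) = blob-unique x≼d (⊏⇒≼ x⊏x′ ◅◅ x′≼d′) b b′
        same-blob (inj₂ x′≼x) = blob-unique (x′≼x ◅◅ x≼d) x′≼d′ b b′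

      below∈ : ∀ {v} → v ∈ below H⁰ a → node v ≼ a
      below∈ = ∈-⟦⟧⁻ (λ v → node v ≼? a)

      -- The anchors start low and the last vertex is up, so some edge of the walk leads from a low
      -- anchor to an up one, unless the low anchor is that last vertex itself.
      walk : ∀ {x w u} → Star (Adj (G [ below H⁰ a ])) x u → Anchor x w → Low w →
             E ⊢ node u ⊴ a → Up u → Step E a
      walk ε (inj₁ (_ , refl))        low _   up = unchanged (inj₁ (low , up)) ε
      walk ε (inj₂ (d , b , q , _)) low u⊴a up = contradiction u⊴a (blob-⋬ b q)
      walk (_◅_ {j = x′} (x∈ , x′∈ , e) p) anc low u⊴a up
        with w′ , anc′ ← anchor x′ (below∈ x′∈) | status (anchor-⊴ anc′)
      ... | inj₁ low′ = walk p anc′ low′ u⊴a up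
      ... | inj₂ up′  = crossing (below∈ x∈) (below∈ x′∈) e anc low anc′ up′

    step : Step E a
    step = choose (status u⊴a) free
      where
      u v : Fin n
      u = proj₁ a∈R
      v = proj₁ (proj₂ a∈R)

      u≼a : node u ≼ a
      u≼a = proj₁ (proj₂ (proj₂ a∈R))

      v⋠a : ¬ (node v ≼ a)
      v⋠a = proj₁ (proj₂ (proj₂ (proj₂ a∈R)))

      free : Free u v
      free = proj₂ (proj₂ (proj₂ (proj₂ a∈R)))

      a⊏v : a ⊏ node v
      a⊏v = adj-leaving (free⇒G free) u≼a v⋠a

      u⊴a : E ⊢ node u ⊴ a
      u⊴a = free-⊴ free u≼a (⊏⇒≼ a⊏v)

      via : Up u → Step E a
      via up = walk (below-connected a
                      (∈-⟦⟧⁺ (λ v → node v ≼? a) (subst (_≼ a) (sym (node-rep a)) ε))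
                      (∈-⟦⟧⁺ (λ v → node v ≼? a) u≼a))
                    (inj₁ (subst (λ x → E ⊢ x ⊴ a) (sym (node-rep a)) ε , refl)) ε u⊴a up

      choose : Low u ⊎ Up u → Free u v → Step E a
      choose (inj₂ up)  _                = via up
      -- An edge of `T∪` is always a link, so `u` is connected to `v` above `a`.
      choose (inj₁ _)   (inj₁ e)         = via (v , a⊏v , inj₁ e ◅ ε)
      -- The free edge itself, which ends in `S`, becomes the edge of `a`.
      choose (inj₁ low) (inj₂ (e , v∈S)) = changed u≼a (inj₁ (v∈S , v⋠a , e)) λ E⊑E′ _ eq _ →
        v , a⊏v , conn-sym (conn-weaken ⊏⇒≼ (conn-mono E⊑E′ low)) ◅◅ (own-link eq e ◅ ε)

  -- The initial assignment and its completion from the deepest level upwards.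

  private
    -- Nodes outside `R` other than the root receive their final edge here; the rest start with the
    -- placeholder.
    pick : ∀ a → Dec (R a) → (p : Maybe Node) → parent a ≡ p → Fin n × Fin n
    pick a (no _) (just p) c with u , v , _ ← child-edge c = v , u
    pick a (no _) nothing  _ = default a
    pick a (yes _) _       _ = default a

    initial : Assignment
    initial a = pick a (R? a) (parent a) refl

    pick-∈R : ∀ {a} → R a → ∀ d p eq → pick a d p eq ≡ default a
    pick-∈R a∈R (yes _)  p eq = refl
    pick-∈R a∈R (no a∉R) p eq = contradiction a∈R a∉R

    pick-∉R : ∀ {a p} → ¬ R a → a childOf p → ∀ d q eq → let t , s = pick a d q eq in node s ≡ p × Adj G t s
    pick-∉R a∉R c (yes a∈R) q eq = contradiction a∈R a∉R
    pick-∉R {p = p} a∉R c (no _) nothing eq with () ← trans (sym c) eq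
    pick-∉R {p = p} a∉R c (no _) (just q) eq with refl ← childOf-unique c eq
      with u , v , u∈ , v∈ , e ← child-edge eq = ∈-⟦⟧⁻ (λ v → node v Finₚ.≟ p) u∈ , adj-sym G e

    pick-below : ∀ a d p eq → node (proj₁ (pick a d p eq)) ≼ a
    pick-below a (yes _) p eq = subst (_≼ a) (sym (node-rep a)) ε
    pick-below a (no _) nothing eq = subst (_≼ a) (sym (node-rep a)) ε
    pick-below a (no _) (just q) eq with u , v , u∈ , v∈ , e ← child-edge eq = ∈-⟦⟧⁻ (λ v → node v ≼? a) v∈

    initial-default : ∀ {a} → R a → initial a ≡ default a
    initial-default {a} a∈R = pick-∈R a∈R (R? a) (parent a) refl

    initial-valid : Valid initial
    initial-valid = record
      { tgt-below = λ a → pick-below a (R? a) (parent a) refl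
      ; par-∉R    = λ {a} a∉R c → pick-∉R a∉R c (R? a) (parent a) refl
      ; par-∈R    = λ {a} a∈R → subst (λ (t , p) → Choice initial a t p) (sym (initial-default a∈R))
          (inj₂ (subst (λ x → initial ⊢ x ⊴ a) (sym (node-rep a)) ε ,
                 λ d⊏a _ a≼d _ → ⊏⇒⋠ d⊏a (subst (_≼ _) (node-rep a) a≼d)))
      }

    -- `P` holds for the nodes treated so far. `pending` provides the placeholder that `step`
    -- requires at an untreated node of `R`.
    record State (P : Node → Set) : Set where
      field
        E       : Assignment
        valid   : Valid E
        settled : ∀ {a} → R a → P a → Attached E a
        pending : ∀ {a} → R a → P a ⊎ E a ≡ default a

    settle : ∀ {P a} → (∀ {γ} → γ ⊏ a → P γ) → State P → State (λ x → x ≡ a ⊎ P x)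
    settle {P} {a} below-P st with R? a
    ... | no a∉R = record
      { E = E ; valid = valid
      ; settled = λ { r (inj₁ refl) → contradiction r a∉R ; r (inj₂ p) → settled r p }
      ; pending = λ r → [ inj₁ ∘ inj₂ , inj₂ ]′ (pending r) }
      where open State st
    ... | yes a∈R with State.pending st a∈R
    ...   | inj₁ p = record
      { E = E ; valid = valid
      ; settled = λ { r (inj₁ refl) → settled r p ; r (inj₂ q) → settled r q }
      ; pending = λ r → [ inj₁ ∘ inj₂ , inj₂ ]′ (pending r) }
      where open State st
    ...   | inj₂ def with E′ , valid′ , off , att ← step (State.valid st) a∈R def
                            (λ r γ⊏a → State.settled st r (below-P γ⊏a)) = record
      { E = E′ ; valid = valid′
      ; settled = λ { r (inj₁ refl) → att ; r (inj₂ q) → attached-mono (off⇒⊑ def off) (settled r q) }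
      ; pending = pending′ }
      where
      open State st
      pending′ : ∀ {x} → R x → (x ≡ a ⊎ P x) ⊎ E′ x ≡ default x
      pending′ {x} r with x Finₚ.≟ a
      ... | yes x≡a = inj₁ (inj₁ x≡a)
      ... | no x≢a  = [ inj₁ ∘ inj₂ , (λ eq → inj₂ (trans (sym (off x≢a)) eq)) ]′ (pending r)

    state-⇔ : ∀ {P Q} → (∀ {x} → P x → Q x) → (∀ {x} → Q x → P x) → State P → State Q
    state-⇔ f g st = record
      { E = E ; valid = valid ; settled = λ r q → settled r (g q)
      ; pending = λ r → [ inj₁ ∘ f , inj₂ ]′ (pending r) }
      where open State st

    settle-all : ∀ {P} xs → (∀ {x γ} → x ∈ˡ xs → γ ⊏ x → P γ) → State P → State (λ x → x ∈ˡ xs ⊎ P x)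
    settle-all [] _ = state-⇔ inj₂ λ { (inj₂ p) → p }
    settle-all (x ∷ xs) below-P st = state-⇔
      (λ { (inj₁ eq) → inj₁ (here eq) ; (inj₂ (inj₁ x∈)) → inj₁ (there x∈) ; (inj₂ (inj₂ p)) → inj₂ p })
      (λ { (inj₁ (here eq)) → inj₁ eq ; (inj₁ (there x∈)) → inj₂ (inj₁ x∈) ; (inj₂ p) → inj₂ (inj₂ p) })
      (settle (λ γ⊏x → inj₂ (below-P (here refl) γ⊏x)) (settle-all xs (λ x∈ → below-P (there x∈)) st))

    -- Strict descendants of a node at depth `k` are deeper, so each level can be treated in any
    -- order. The start `k = suc height` is vacuous.
    levels : ∀ j k → j + k ≡ suc height → State (λ x → k ≤ depth x)
    levels zero k refl = record
      { E = initial ; valid = initial-valid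
      ; settled = λ {a} _ lt → contradiction (depth≤height a) (ℕₚ.<⇒≱ lt)
      ; pending = λ r → inj₂ (initial-default r) }
    levels (suc j) k eq = state-⇔
      (λ { (inj₁ x∈) → ℕₚ.≤-reflexive (sym (proj₂ (∈-filter⁻ level? {xs = allFin _} x∈))) ; (inj₂ lt) → ℕₚ.<⇒≤ lt })
      (λ {x} k≤ → [ inj₂ , (λ k≡ → inj₁ (∈-filter⁺ level? (∈-allFin x) (sym k≡))) ]′ (ℕₚ.m≤n⇒m<n∨m≡n k≤))
      (settle-all (filter level? (allFin _))
        (λ {x} {γ} x∈ γ⊏x → subst (_< depth γ) (proj₂ (∈-filter⁻ level? {xs = allFin _} x∈)) (depth-⊏ γ⊏x))
        (levels j (suc k) (trans (ℕₚ.+-suc j k) eq)))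
      where
      level? : U.Decidable (λ x → depth x ≡ k)
      level? x = depth x ℕₚ.≟ k

  connectors : ∃[ E ] (Valid E × (∀ {a} → R a → Attached E a))
  connectors = E , valid , λ r → settled r z≤n
    where open State (levels (suc height) 0 (ℕₚ.+-identityʳ _))

  -- Links stay inside components, and the degree bound outside `S`.

  module _ {E : Assignment} (valid : Valid E) where
    open Valid valid

    extra? : Decidable (Extra E U.U)
    extra? u v = Finₚ.any? λ γ → M? E γ ×-dec yes tt ×-dec
      (((u Finₚ.≟ tgt E γ) ×-dec (v Finₚ.≟ par E γ)) ⊎-dec ((u Finₚ.≟ par E γ) ×-dec (v Finₚ.≟ tgt E γ)))
      ×-dec adj? G u v

    -- A free edge merges the path to the node of its upper end. Any other edge assigned to `γ` has
    -- both ends merged into `γ` or, for `γ ∉ R`, into the parent of `γ`.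
    link⇒common : ∀ {u v} → Link E U.U u v → ∃[ x ] (E ⊢ node u ⊴ x × E ⊢ node v ⊴ x)
    link⇒common {u} {v} (inj₁ e) with adj-comparable (T∪⇒G e)
    ... | inj₁ u⊏v = node v , free-⊴ (inj₁ e) (⊏⇒≼ u⊏v) ε , ε
    ... | inj₂ v≼u = node u , ε , free-⊴ (inj₁ (adj-sym T∪ e)) v≼u ε
    link⇒common (inj₂ (γ , γ∈M , _ , s , _)) = let x , p , q = common in x , ends s p q
      where
      common : ∃[ x ] (E ⊢ node (tgt E γ) ⊴ x × E ⊢ node (par E γ) ⊴ x)
      common with R? γ
      ... | yes γ∈R with par-∈R γ∈R
      ...   | inj₂ (par⊴γ , _) = γ , tgt-⊴ valid γ∈M , par⊴γ
      ...   | inj₁ (∈S , par⋠γ , e) = _ ,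
              free-⊴ (inj₂ (e , ∈S)) (tgt-below γ ◅◅ ⊏⇒≼ (adj-leaving e (tgt-below γ) par⋠γ)) ε , ε
      common | no γ∉R with M-cases γ∈M
      ... | inj₁ γ∈R = contradiction γ∈R γ∉R
      ... | inj₂ (_ , _ , (p , c , _) , _) = p , tgt-⊴ valid γ∈M ◅◅ ((γ∈M , c) ◅ ε) ,
                                            subst (λ x → E ⊢ x ⊴ p) (sym (proj₁ (par-∉R γ∉R c))) ε

      ends : ∀ {u v x} → Ends E γ u v → E ⊢ node (tgt E γ) ⊴ x → E ⊢ node (par E γ) ⊴ x →
             E ⊢ node u ⊴ x × E ⊢ node v ⊴ x
      ends (inj₁ (refl , refl)) p q = p , q
      ends (inj₂ (refl , refl)) p q = q , p

    -- The common node `x` and `t` are both ancestors of `node u`. If `x` were strictly above `t`,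
    -- then `t` would lie on a merged path.
    link-closed : ∀ {t u v} → ¬ M E t → Link E U.U u v → E ⊢ node u ⊴ t → E ⊢ node v ⊴ t
    link-closed {t} {u} t∉M l u⊴t with x , u⊴x , v⊴x ← link⇒common l
      with ancestors-comparable (⊴⇒≼ u⊴x) (⊴⇒≼ u⊴t)
    ... | inj₁ x≼t = v⊴x ◅◅ ⊴-suffix u⊴t (⊴⇒≼ u⊴x) x≼t
    ... | inj₂ t⊏x = contradiction (⊴-elim u⊴x (⊴⇒≼ u⊴t) t⊏x) t∉M

    -- Every connecting edge at w ∉ S is charged to an ancestor a of its node:
    -- to its own node a, or, if it joins d ∉ R to the parent of d, to some a
    -- whose target forced d to be merged.
    Charge : Node → Fin n → Fin n → Set
    Charge a w z = Ends E a w z ⊎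
      ∃[ d ] (¬ R d × d ⊏ a × node (tgt E a) ≼ d × w ≡ par E d × z ≡ tgt E d)

    Charged : Fin n → Fin n → Set
    Charged w z = ∃[ a ] (M E a × node w ≼ a × Charge a w z × Adj G w z)

    charged : ∀ {w z} → w ∉ S → Extra E U.U w z → Charged w z
    charged w∉S (γ , γ∈M , _ , s@(inj₁ (refl , _)) , e) = γ , γ∈M , tgt-below γ , inj₁ s , e
    charged w∉S (γ , γ∈M , _ , s@(inj₂ (refl , refl)) , e) with R? γ
    ... | yes γ∈R with par-∈R γ∈R
    ...   | inj₁ (∈S , _)    = contradiction ∈S w∉S
    ...   | inj₂ (par⊴γ , _) = γ , γ∈M , ⊴⇒≼ par⊴γ , inj₁ s , e
    charged w∉S (γ , γ∈M , _ , s@(inj₂ (refl , refl)) , e) | no γ∉R with M-cases γ∈M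
    ... | inj₁ γ∈R = contradiction γ∈R γ∉R
    ... | inj₂ (a , a∈M , γ⊏a@(p , c , p≼a) , q) =
      a , a∈M , subst (_≼ a) (sym (proj₁ (par-∉R γ∉R c))) p≼a , inj₂ (γ , γ∉R , γ⊏a , q , refl , refl) , e

    -- `par E d` lies in the parent of `d`, strictly above the target of `a`, so `w` is not that
    -- target. If `w` is the parent end of `a`, either the last condition of `Choice` applies or `w`
    -- does not lie below `a`.
    own-vs-forced : ∀ {a w z d} → M E a → node w ≼ a → Ends E a w z →
                    ¬ R d → d ⊏ a → node (tgt E a) ≼ d → ¬ (w ≡ par E d)
    own-vs-forced _ _ (inj₁ (refl , _)) d∉R d⊏a@(p , c , _) t≼d eq =
      ⊏⇒⋠ (p , c , ε) (subst (_≼ _) (trans (cong node eq) (proj₁ (par-∉R d∉R c))) t≼d)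
    own-vs-forced {a} a∈M w≼a (inj₂ (refl , _)) d∉R d⊏a t≼d eq with R? a
    ... | yes a∈R with par-∈R a∈R
    ...   | inj₁ (_ , w⋠a , _) = w⋠a w≼a
    ...   | inj₂ (_ , distinct) = distinct d⊏a d∉R t≼d (sym eq)
    own-vs-forced {a} a∈M w≼a (inj₂ (refl , _)) d∉R d⊏a t≼d eq | no a∉R with M-cases a∈M
    ... | inj₁ a∈R = a∉R a∈R
    ... | inj₂ (_ , _ , (p , c , _) , _) = ⊏⇒⋠ (p , c , ε) (subst (_≼ a) (proj₁ (par-∉R a∉R c)) w≼a)

    charge-functional : ∀ {a w z z′} → M E a → node w ≼ a → Charge a w z → Adj G w z →
                        Charge a w z′ → Adj G w z′ → z ≡ z′
    charge-functional _ _ (inj₁ (inj₁ (_ , refl))) _ (inj₁ (inj₁ (_ , refl))) _ = refl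
    charge-functional _ _ (inj₁ (inj₂ (_ , refl))) _ (inj₁ (inj₂ (_ , refl))) _ = refl
    charge-functional _ _ (inj₁ (inj₁ (_ , z≡))) e (inj₁ (inj₂ (w≡ , _))) _ =
      contradiction e (adj-irrefl G (trans w≡ (sym z≡)))
    charge-functional _ _ (inj₁ (inj₂ (_ , z≡))) e (inj₁ (inj₁ (w≡ , _))) _ =
      contradiction e (adj-irrefl G (trans w≡ (sym z≡)))
    charge-functional a∈M w≼a (inj₁ s) _ (inj₂ (_ , d∉R , d⊏a , t≼d , eq , _)) _ =
      contradiction eq (own-vs-forced a∈M w≼a s d∉R d⊏a t≼d)
    charge-functional a∈M w≼a (inj₂ (_ , d∉R , d⊏a , t≼d , eq , _)) _ (inj₁ s) _ =
      contradiction eq (own-vs-forced a∈M w≼a s d∉R d⊏a t≼d)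
    -- Both forced nodes are children of `node w` above the target of `a`, hence equal.
    charge-functional _ _ (inj₂ (d , d∉R , (_ , c , _) , t≼d , eq , refl)) _
                          (inj₂ (d′ , d′∉R , (_ , c′ , _) , t≼d′ , eq′ , refl)) _
      with refl ← trans (sym (proj₁ (par-∉R d∉R c))) (trans (cong node (trans (sym eq) eq′)) (proj₁ (par-∉R d′∉R c′)))
      with ancestors-comparable t≼d t≼d′
    ... | inj₁ d≼d′ = cong (tgt E) (childOf-≼⇒≡ c c′ d≼d′)
    ... | inj₂ d′⊏d = cong (tgt E) (sym (childOf-≼⇒≡ c′ c (⊏⇒≼ d′⊏d)))

    extra-degree : ∀ {w} → w ∉ S → ∣ ⟦ extra? w ⟧ ∣ ≤ depth (node w)
    extra-degree {w} w∉S = ∣p∣≤-injection ⟦ extra? w ⟧ (λ z∈ → slot (charges z∈))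
      (λ x∈ y∈ → slot-injective (charges x∈) (charges y∈))
      where
      charges : ∀ {z} → z ∈ ⟦ extra? w ⟧ → Charged w z
      charges z∈ = charged w∉S (∈-⟦⟧⁻ (extra? w) z∈)

      0<depth : ∀ {a} → M E a → 0 < depth a
      0<depth {a} a∈M with ≼-split (toRoot a)
      ... | inj₁ refl   = contradiction a∈M root∉M
      ... | inj₂ a⊏root = ℕₚ.≤-<-trans z≤n (depth-⊏ a⊏root)

      pred-depth< : ∀ {a} → M E a → node w ≼ a → pred (depth a) < depth (node w)
      pred-depth< a∈M w≼a =
        ℕₚ.<-≤-trans (ℕₚ.≤-reflexive (ℕₚ.suc-pred _ {{>-nonZero (0<depth a∈M)}})) (depth-≼ w≼a)

      -- The root is never merged, so charged nodes have depths from 1 to `depth (node w)`; `pred`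
      -- shifts these to start at 0.
      slot : ∀ {z} → Charged w z → Fin (depth (node w))
      slot (a , a∈M , w≼a , _) = fromℕ< (pred-depth< a∈M w≼a)

      slot-injective : ∀ {x y} (p : Charged w x) (q : Charged w y) → slot p ≡ slot q → x ≡ y
      slot-injective (a , a∈M , w≼a , ch , e) (b , b∈M , w≼b , ch′ , e′) eq
        with refl ← ancestor-depth-injective w≼a w≼b
                      (ℕₚ.pred-injective {{>-nonZero (0<depth a∈M)}} {{>-nonZero (0<depth b∈M)}}
                        (Finₚ.fromℕ<-injective _ _ (pred-depth< a∈M w≼a) (pred-depth< b∈M w≼b) eq)) =
        charge-functional a∈M w≼a ch e ch′ e′

-- The hierarchy of a colour class

LowDegreeHierarchy : ∀ {n} → Graph {n} ⊤ → Hierarchy n → Subset n → (Subset n → Set) → Set₁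
LowDegreeHierarchy {n} G H⁰ S B =
  Σ[ H ∈ Hierarchy n ]
    ( Coarsening H⁰ H
    × IsHierarchyOf G H
    × (∀ K → Σ[ T ∈ Graph (part H K) ]
        ( IsSpanningTree G (part H K) T
        × (∀ v → v ∈ part H K → v ∉ S → degree T v ≤ 3 ·log₂ n)))
    × (∀ K → B (below H K)))

module _ {n : ℕ} {G : Graph {n} ⊤} {H⁰ : Hierarchy n} (base : IsBaseHierarchy G H⁰) where

  private
    module base = IsBaseHierarchy base
    module H⁰ = Hierarchy H⁰
  open TreeProperties H⁰.tree using (depth≤height)

  module _ (S : Subset n) where

    -- The colouring is chosen for the subtrees of `H⁰`, so the subtree of a component has to be
    -- identified with one of them.
    IsSubtreeAvoiding : Subset n → Set
    IsSubtreeAvoiding U =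
      ∃[ t ] (U ⊆ below H⁰ t × below H⁰ t ⊆ U × (∀ {v} → v ∈ outerNeighbours G (below H⁰ t) → v ∉ S))

    open Connectors base S hiding (⊴⇒≼)

    contract : ∀ {E} → Valid E → (∀ {a} → R a → Attached E a) → U.Decidable (M E) →
               LowDegreeHierarchy G H⁰ S IsSubtreeAvoiding
    contract {E} valid attached merged? = H , coarsening , isHierarchyOf base.isHierarchyOf , tree , λ K →
      topOf K , below⁻ , below⁺ , avoids-S K
      where
      open Contraction H⁰ merged? root∉M hiding (_⊴_; ⊴⇒≼)

      -- An edge from the subtree into `S` would be free and put `topOf K` into `R`, hence into `M`.
      avoids-S : ∀ K {v} → v ∈ outerNeighbours G (below H⁰ (topOf K)) → v ∉ S
      avoids-S K {v} v∈ v∈S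
        with v∉ , u , u∈ , e ← ∈-outer⁻ G _ v∈ =
        topOf∉M K (R⊆M (u , v , ∈-⟦⟧⁻ (λ v → node v H⁰.≼? topOf K) u∈ ,
          (λ v≼ → v∉ (∈-⟦⟧⁺ (λ v → node v H⁰.≼? topOf K) v≼)) , inj₂ (e , v∈S)))

      links : Graph {n} ⊤
      links = record
        { Adj        = Link E U.U
        ; adj?       = λ u v → adj? T∪ u v ⊎-dec extra? valid u v
        ; adj-sym    = link-sym
        ; adj-irrefl = λ eq l → adj-irrefl G eq (link⇒G l)
        ; adj-in     = λ _ → ∈⊤
        }

      within : ∀ {K u v} → E ⊢ node u ⊴ topOf K → Conn E U.U u v → Star (Adj (links [ part H K ])) u v
      within u⊴ ε = ε
      within {K} u⊴ (l ◅ p) = let w⊴ = link-closed valid (topOf∉M K) l u⊴ in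
        (part⁺ u⊴ , part⁺ w⊴ , l) ◅ within w⊴ p

      -- The top is outside `R`, so `conn-rep` joins every vertex to its representative, and
      -- `link-closed` keeps the path inside the component.
      connected : ∀ K → Connected (links [ part H K ])
      connected K u∈ v∈ = within (part⁻ u∈) (toRep u∈ ◅◅ conn-sym (toRep v∈))
        where
        toRep : ∀ {v} → v ∈ part H K → Conn E U.U v (rep (topOf K))
        toRep v∈ = conn-weaken (λ _ → tt)
          (conn-rep valid (λ r _ → attached r) (λ r → topOf∉M K (R⊆M r)) (part⁻ v∈))

      links-degree : ∀ {W} (T : Graph W) {v} → (∀ {w} → Adj T v w → Link E U.U v w) → v ∉ S →
                     degree T v ≤ 3 ·log₂ n
      links-degree T {v} sub v∉S = begin
        2 ^ degree T v                           ≤⟨ ℕₚ.^-monoʳ-≤ 2 bound ⟩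
        2 ^ (degree T∪ v + H⁰.height)            ≡⟨ ℕₚ.^-distribˡ-+-* 2 (degree T∪ v) H⁰.height ⟩
        2 ^ degree T∪ v * 2 ^ H⁰.height          ≤⟨ ℕₚ.*-mono-≤ (base.T∪-degree v) (IsHierarchyOf.height-bound base.isHierarchyOf) ⟩
        n ^ 2 * n ^ 1                            ≡⟨ ℕₚ.^-distribˡ-+-* n 2 1 ⟨
        n ^ 3                                    ∎
        where
        open ℕₚ.≤-Reasoning
        cover : ⟦ adj? T v ⟧ ⊆ ⟦ adj? T∪ v ⟧ ∪ ⟦ extra? valid v ⟧
        cover w∈ with sub (∈-⟦⟧⁻ (adj? T v) w∈)
        ... | inj₁ e = x∈p∪q⁺ (inj₁ (∈-⟦⟧⁺ (adj? T∪ v) e))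
        ... | inj₂ e = x∈p∪q⁺ (inj₂ (∈-⟦⟧⁺ (extra? valid v) e))

        bound : degree T v ≤ degree T∪ v + H⁰.height
        bound = ℕₚ.≤-trans (p⊆q⇒∣p∣≤∣q∣ cover)
          (ℕₚ.≤-trans (∣p∪q∣≤∣p∣+∣q∣ ⟦ adj? T∪ v ⟧ ⟦ extra? valid v ⟧)
            (ℕₚ.+-monoʳ-≤ (degree T∪ v) (ℕₚ.≤-trans (extra-degree valid v∉S) (depth≤height (node v)))))

      tree : ∀ K → Σ[ T ∈ Graph (part H K) ]
               ( IsSpanningTree G (part H K) T
               × (∀ v → v ∈ part H K → v ∉ S → degree T v ≤ 3 ·log₂ n))
      tree K with T , isTree , T⊆ ← spanningTree (links [ part H K ]) (connected K) =
        T , (isTree , id , λ e → let u∈ , v∈ , l = T⊆ e in u∈ , v∈ , link⇒G l) ,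
        λ v _ v∉S → links-degree T (λ e → proj₂ (proj₂ (T⊆ e))) v∉S

    lowDegreeHierarchy : LowDegreeHierarchy G H⁰ S IsSubtreeAvoiding
    lowDegreeHierarchy = let E , valid , attached = connectors in contract valid attached (M? E)

  -- Colourings that hit all large outer neighbourhoods in `H⁰`.

  OuterHitting : (f : ℕ) → (Fin n → Fin (suc f)) → Set
  OuterHitting f col = ∀ γ → let N = outerNeighbours G (below H⁰ γ) in
    ∣ N ∣ ≤ 2 * f ·log₂ n ⊎ (∀ i → ∃[ v ] (v ∈ N × col v ≡ i))

  -- For `f ≥ n` every colouring works: a representative of `γ` is no outer neighbour, so fewer than
  -- `n ≤ f` vertices are.
  outerHitting : ∀ f .{{_ : NonZero f}} → ∃[ col ] OuterHitting f col
  outerHitting f with f ℕₚ.<? n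
  ... | yes f<n = hittingColouring (λ γ → outerNeighbours G (below H⁰ γ)) f
                    (Finₚ.injective⇒≤ {f = proj₁ ∘ cls-surj} rep-injective) f<n
    where
    open Hierarchy H⁰ using (cls-surj)
    rep-injective : ∀ {γ δ} → proj₁ (cls-surj γ) ≡ proj₁ (cls-surj δ) → γ ≡ δ
    rep-injective {γ} {δ} eq = trans (sym (proj₂ (cls-surj γ) refl)) (proj₂ (cls-surj δ) eq)
  ... | no f≮n = (λ _ → zero) , λ γ → inj₁ (few n (ℕₚ.≮⇒≥ f≮n) (not-all γ))
    where
    open Hierarchy H⁰ using (cls-surj; _≼?_)
    not-all : ∀ γ → ∣ outerNeighbours G (below H⁰ γ) ∣ < n
    not-all γ with r , eq ← cls-surj γ =
      subst (∣ outerNeighbours G (below H⁰ γ) ∣ <_) (∣⊤∣≡n n)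
        (p⊂q⇒∣p∣<∣q∣ (⊆⊤ , r , ∈⊤ , λ r∈ →
          proj₁ (∈-outer⁻ G _ r∈)
            (∈-⟦⟧⁺ (λ v → cls H⁰ v ≼? γ) (subst (λ x → Hierarchy._≼_ H⁰ x γ) (sym (eq refl)) ε))))

    few : ∀ n {k} → n ≤ f → k < n → k ≤ 2 * f ·log₂ n
    -- Since `log 1 = 0`, the set has to be empty here, which the strict bound `k < n` ensures.
    few (suc zero)      n≤f (s≤s z≤n) = ℕₚ.≤-reflexive (sym (ℕₚ.^-zeroˡ (2 * f)))
    few n@(suc (suc _)) n≤f k<n =
      ℕₚ.≤-trans (ℕₚ.^-monoʳ-≤ 2 (ℕₚ.≤-trans (ℕₚ.<⇒≤ k<n) (ℕₚ.≤-trans n≤f (ℕₚ.m≤m+n f _))))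
                 (ℕₚ.^-monoˡ-≤ (2 * f) (s≤s (s≤s z≤n)))

-- The partition into colour classes.

colourClass : ∀ {n k} → (Fin n → Fin k) → Fin k → Subset n
colourClass col i = ⟦ (λ v → col v Finₚ.≟ i) ⟧

∈-colourClass : ∀ {n k} (col : Fin n → Fin k) {v i} → col v ≡ i → v ∈ colourClass col i
∈-colourClass col {i = i} = ∈-⟦⟧⁺ (λ v → col v Finₚ.≟ i)

colourClass-partition : ∀ {n k} (col : Fin n → Fin k) → IsPartition (colourClass col)
colourClass-partition col v = col v , ∈-colourClass col refl , ∈-⟦⟧⁻ (λ v → col v Finₚ.≟ _)

theorem3p2 : Σ[ C ∈ ℕ ] (∀ (n : ℕ) (G : Graph {n} ⊤) → Connected G →
    (H⁰ : Hierarchy n) → IsBaseHierarchy G H⁰ →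
    (f : ℕ) → 1 ≤ f →
    Σ[ S ∈ (Fin (suc f) → Subset n) ] (IsPartition S × (∀ i →
    Σ[ H ∈ Hierarchy n ]
    ( Coarsening H⁰ H
    × IsHierarchyOf G H
    × (∀ K → Σ[ T ∈ Graph (part H K) ]
    ( IsSpanningTree G (part H K) T
    × (∀ v → v ∈ part H K → v ∉ S i → degree T v ≤ 3 ·log₂ n)))
    × (∀ K → ∣ outerNeighbours G (below H K) ∣ ≤ C * f ·log₂ n)))))
-- The constant is the exponent in the bound `n ^ 2` on the number of requirements.
theorem3p2 = 2 , λ n G _ H⁰ base f 1≤f → colour-hierarchies base f (outerHitting base f {{>-nonZero 1≤f}})
  where
  colour-hierarchies : ∀ {n} {G : Graph {n} ⊤} {H⁰ : Hierarchy n} (base : IsBaseHierarchy G H⁰) f →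
    ∃[ col ] OuterHitting base f col →
    Σ[ S ∈ (Fin (suc f) → Subset n) ] (IsPartition S × (∀ i →
      LowDegreeHierarchy G H⁰ (S i) (λ U → ∣ outerNeighbours G U ∣ ≤ 2 * f ·log₂ n)))
  colour-hierarchies {n} {G} base f (col , hits) = colourClass col , colourClass-partition col , λ i →
    let H , coarse , hier , trees , tops = lowDegreeHierarchy base (colourClass col i) in
    H , coarse , hier , trees , λ K → bound i (tops K)
    where
    bound : ∀ i {U} → IsSubtreeAvoiding base (colourClass col i) U → ∣ outerNeighbours G U ∣ ≤ 2 * f ·log₂ n
    bound i (t , U⊆ , ⊆U , avoids) with hits t
    ... | inj₁ small = ℕₚ.≤-trans (ℕₚ.^-monoʳ-≤ 2 (p⊆q⇒∣p∣≤∣q∣ (outerNeighbours-cong G U⊆ ⊆U))) small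
    -- A large neighbourhood would contain the colour `i`, that is, a vertex of `S`.
    ... | inj₂ hit with v , v∈ , eq ← hit i = contradiction (∈-colourClass col eq) (avoids v∈)
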